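{- Let $n\geq3$ and $2\le k\le n$ be integers. The $\mathcal{G}^k_n$-parking functions are exactly the $k$-partial parking functions in $[n]^n$, and their number is $(n+1)^{n-1}$.
   Context: $[m,n]=\{i\in\mathbb{Z}\mid m\le i\le n\}$, $[n]=[1,n]$. The arrangement $\mathcal{A}^k_n$ in $\mathbb{R}^n$ consists of the hyperplanes $x_i=x_j$ for $1\le i<j\le n$; $x_1=x_j+i$ for $1\le i<j\le n$ with $i<k$; and $x_i=x_j+1$ for $k\le i<j\le n$. $\mathcal{G}^k_n$ is the directed multigraph on vertex set $[n]$ having one arc $(i,j)$ for each hyperplane $x_i=x_j$ ($i<j$) of $\mathcal{A}^k_n$ and one arc $(j,i)$ for each hyperplane $x_i=x_j+a$ ($a\in\mathbb{N}$) of $\mathcal{A}^k_n$ (multiple arcs counted with multiplicity). For a directed loopless connected multigraph $\mathcal{G}=([n],A)$, $\mathbf{a}\in\mathbb{N}^n$ is a $\mathcal{G}$-parking function if for every nonempty $I\subseteq[n]$ there is $i\in I$ such that the number of arcs $(i,j)\in A$ with $j\notin I$, counted with multiplicity, is greater than $a_i-2$. Parking Algorithm with input $\mathbf{a}\in[n]^n$: start with $\mathrm{spp}=(0,\dotsc,0)\in\mathbb{Z}^{2n}$ indexed by positions $1,\dotsc,2n$; for each $i\in[n]$ in descending order set $p=a_i$, increase $p$ by one while $\mathrm{spp}(p)\ne0$, then set $\mathrm{pp}(i)=p$, $\mathrm{spp}(p)=i$. $\mathbf{a}$ parks $i$ if $\mathrm{pp}(i)\le n$. Centre: $Z(\mathbf{b})$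 is the largest set $\{i_1,\dotsc,i_m\}\subseteq[n]$ with $i_1>\dotsb>i_m$ and $b_{i_j}\le j$ for all $j\in[m]$. Let $\pi\in\mathfrak{S}_n$ with $\pi(i)=i$ for $i<k$ and $a_{\pi(i)}\ge a_{\pi(i+1)}$ for $k\le i<n$, and $\mathbf{a}^{(k)}:=\mathbf{a}\circ\pi$. $\mathbf{a}\in[n]^n$ is a $k$-partial parking function if $\mathbf{a}$ parks every element of $[k,n]$ and $1\in Z(\mathbf{a}^{(k)})$. -}

module Defs where

open import Data.Nat using (ℕ; zero; suc; _+_; _≤_; _<_; _≥_; _<ᵇ_; _≤ᵇ_; _≡ᵇ_)
open import Data.Bool using (Bool; true; false; if_then_else_; _∧_; not)
open import Data.Fin using (Fin; toℕ)
open import Data.List using (List; []; _∷_; [_]; _++_; concatMap; map; length; filterᵇ; reverse; upTo; foldl)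
open import Data.Vec using (Vec; lookup; tabulate; allFin)
open import Data.Vec as V using ()
open import Data.Fin.Subset using (Subset; Nonempty; _⊆_) renaming (_∈_ to _∈ₛ_)
open import Data.Fin.Permutation using (Permutation′; _⟨$⟩ʳ_)
open import Data.Product using (Σ; ∃; _×_; _,_; proj₁; proj₂)
open import Relation.Binary.PropositionalEquality using (_≡_)

finList : (n : ℕ) → List (Fin n)
finList n = V.toList (allFin n)

-- Vertex i : Fin n stands for the label toℕ i + 1 ∈ [n].
label : {n : ℕ} → Fin n → ℕ
label i = suc (toℕ i)

-- Hyperplane  x_i = x_j + c   (c = 0 : the hyperplane x_i = x_j)

record Hyperplane (n : ℕ) : Set where
  constructor hyp
  field
    hi : Fin n
    hj : Fin n
    hc : ℕ

-- The arrangement A^k_n, listing each hyperplane once: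
--   x_i = x_j            for 1 ≤ i < j ≤ n
--   x_1 = x_j + c        for 1 ≤ c < j ≤ n with c < k
--   x_i = x_j + 1        for k ≤ i < j ≤ n
arrangement : (n k : ℕ) → List (Hyperplane n)
arrangement n k =
  concatMap (λ i → concatMap (λ j →
      (if label i <ᵇ label j then [ hyp i j 0 ] else [])
   ++ (if (label i ≡ᵇ 1) ∧ (label i <ᵇ label j)
         then concatMap (λ c → if c <ᵇ k then [ hyp i j c ] else [])
                        (map suc (upTo (toℕ j)))
         else [])
   ++ (if (k ≤ᵇ label i) ∧ (label i <ᵇ label j) then [ hyp i j 1 ] else [])
    ) (finList n)) (finList n)

-- Directed multigraph: list of arcs (with multiplicity)
Arc : ℕ → Set
Arc n = Fin n × Fin n

hypArc : {n : ℕ} → Hyperplane n → Arc n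
hypArc (hyp i j zero)    = (i , j)
hypArc (hyp i j (suc _)) = (j , i)

graphG : (n k : ℕ) → List (Arc n)
graphG n k = map hypArc (arrangement n k)

outDeg : {n : ℕ} → List (Arc n) → Subset n → Fin n → ℕ
outDeg arcs I i =
  length (filterᵇ (λ e → (toℕ (proj₁ e) ≡ᵇ toℕ i) ∧ not (lookup I (proj₂ e))) arcs)

-- G-parking function; a ∈ ℕ^n with ℕ = {1,2,...} (entries positive).
-- "outDeg > a_i - 2" is written as a_i < outDeg + 2 (exact over ℤ).
IsGParking : {n : ℕ} → List (Arc n) → Vec ℕ n → Set
IsGParking {n} arcs a =
  (∀ (i : Fin n) → 1 ≤ lookup a i) ×
  (∀ (I : Subset n) → Nonempty I →
     ∃ λ (i : Fin n) → (i ∈ₛ I) × (lookup a i < outDeg arcs I i + 2))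

InRange : {n : ℕ} → Vec ℕ n → Set
InRange {n} a = ∀ (i : Fin n) → (1 ≤ lookup a i) × (lookup a i ≤ n)

-- Parking algorithm. spp : positions → cars (0 = empty), pp : cars → positions.

-- increase p while spp(p) ≠ 0 (fuel n suffices: at most n-1 cells are occupied)
findFree : ℕ → (ℕ → ℕ) → ℕ → ℕ
findFree zero     spp p = p
findFree (suc f) spp p = if spp p ≡ᵇ 0 then p else findFree f spp (suc p)

parkStep : {n : ℕ} → Vec ℕ n → (ℕ → ℕ) × (Fin n → ℕ) → Fin n → (ℕ → ℕ) × (Fin n → ℕ)
parkStep {n} a (spp , pp) i =
  let p = findFree n spp (lookup a i) in
  ( (λ q → if q ≡ᵇ p then label i else spp q)
  , (λ j → if toℕ j ≡ᵇ toℕ i then p else pp j) )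

parkingPos : {n : ℕ} → Vec ℕ n → Fin n → ℕ
parkingPos {n} a = proj₂ (foldl (parkStep a) ((λ _ → 0) , (λ _ → 0)) (reverse (finList n)))

Parks : {n : ℕ} → Vec ℕ n → Fin n → Set
Parks {n} a i = parkingPos a i ≤ n

-- Centre.  For a subset S = {i_1 > ... > i_m}, the index j of s = i_j in S
-- is the number of t ∈ S with t ≥ s.
rankIn : {n : ℕ} → Subset n → Fin n → ℕ
rankIn {n} S s = length (filterᵇ (λ t → lookup S t ∧ (toℕ s ≤ᵇ toℕ t)) (finList n))

CentreCandidate : {n : ℕ} → Vec ℕ n → Subset n → Set
CentreCandidate b S = ∀ s → s ∈ₛ S → lookup b s ≤ rankIn S s

IsCentre : {n : ℕ} → Vec ℕ n → Subset n → Set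
IsCentre {n} b Z = CentreCandidate b Z × (∀ (S : Subset n) → CentreCandidate b S → S ⊆ Z)

OneIn : {n : ℕ} → Subset n → Set
OneIn {n} Z = ∃ λ (i : Fin n) → (toℕ i ≡ 0) × (i ∈ₛ Z)

SortingPerm : {n : ℕ} → ℕ → Vec ℕ n → Permutation′ n → Set
SortingPerm {n} k a π =
  (∀ (i : Fin n) → label i < k → π ⟨$⟩ʳ i ≡ i) ×
  (∀ (i j : Fin n) → k ≤ label i → toℕ j ≡ suc (toℕ i) →
     lookup a (π ⟨$⟩ʳ i) ≥ lookup a (π ⟨$⟩ʳ j))

compose : {n : ℕ} → Vec ℕ n → Permutation′ n → Vec ℕ n
compose a π = tabulate (λ i → lookup a (π ⟨$⟩ʳ i))

IsPartialPF : {n : ℕ} → ℕ → Vec ℕ n → Set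
IsPartialPF {n} k a =
  (∀ (i : Fin n) → k ≤ label i → Parks a i) ×
  (∃ λ (π : Permutation′ n) → SortingPerm k a π ×
     (∃ λ (Z : Subset n) → IsCentre (compose a π) Z × OneIn Z))

{-# OPTIONS --safe #-}
module Submission where

-- Write κ = k - 1, count indices from 0 and let c(q) be the number of i ≥ κ with
-- aᵢ ≤ q.  The G-parking condition is a burning condition: vertex i burns once
-- aᵢ - 1 is at most its number of arcs to burnt vertices.  Before vertex 0 burns, exactly
-- the r vertices i ≥ κ with aᵢ ≤ r + 1 do, r being maximal with q ≤ c(q) for q ≤ r,
-- and then, from κ - 1 down to 1, each i with aᵢ ≤ 1 + #{burnt j > i}.  Vertex 0 must
-- burn next, which is the centre condition; all the rest burns afterwards iff
-- q ≤ c(q) + κ for q ≤ n, which says that the cars i ≥ κ park in [n].  After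
-- these cars have parked, r + 1 is the first empty spot.
--
-- For the number, summing over the entries 0 < i < κ multiplies (burnt + 1) by n + 1 each
-- time, so it remains to see that the first empty spot, summed over the successful
-- parkings of N = n - κ cars, gives (n + 1)^N.  Park on a circle with n + 1 spots instead;
-- success means that spot 0 stays empty, and rotation invariance turns the sum into
-- the number of all (n + 1)^N preference sequences.

open import Defs
open import Data.Bool using (Bool; true; false; T?; if_then_else_; _∧_; _∨_; not)
open import Data.Bool.Properties using (T-≡; ∧-zeroʳ; ∧-identityʳ; not-involutive)
open import Data.Empty using (⊥; ⊥-elim)
open import Data.Fin using (Fin; zero; suc; toℕ; fromℕ; fromℕ<; inject₁)
import Data.Fin.Properties as Fin
open import Data.Fin.Properties using (toℕ-injective; toℕ<n; toℕ-fromℕ; toℕ-fromℕ<; toℕ-inject₁)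
open import Data.Fin.Permutation as Perm using (Permutation′; _⟨$⟩ʳ_; lift₀; transpose; _∘ₚ_)
open import Data.Fin.Subset using (Subset; Nonempty) renaming (_∈_ to _∈ₛ_)
open import Data.List as List using (List; []; _∷_; [_]; _++_; _∷ʳ_; concatMap; map; foldr; length; filterᵇ; upTo; cartesianProductWith)
open import Data.List.Membership.Propositional using (_∈_)
open import Data.List.Membership.Propositional.Properties using (∈-filter⁺; ∈-filter⁻; ∈-allFin; ∈-cartesianProductWith⁺; ∈-cartesianProductWith⁻)
open import Data.List.Properties using (upTo-∷ʳ; reverse-foldl)
open import Data.List.Relation.Unary.All using ([])
open import Data.List.Relation.Unary.AllPairs using ([]; _∷_)
open import Data.List.Relation.Unary.Any using (here)
open import Data.List.Relation.Unary.Unique.Propositional using (Unique)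
import Data.List.Relation.Unary.Unique.Propositional.Properties as Unique
open import Data.Nat
open import Data.Nat.Properties
open import Algebra.Properties.CommutativeMonoid.Sum +-0-commutativeMonoid using (sum; sum-cong-≗; ∑-distrib-+; sum-permute)
open import Algebra.Properties.CommutativeSemigroup +-commutativeSemigroup using (x∙yz≈y∙xz)
open import Data.Nat.Tactic.RingSolver using (solve-∀)
open import Data.Product using (∃; _×_; _,_; proj₁; proj₂)
open import Data.Sum using (_⊎_; inj₁; inj₂)
open import Data.Vec as Vec using (Vec; []; _∷_; lookup; tabulate; drop; replicate; _[_]≔_)
open import Data.Vec.Properties using (lookup∘tabulate; tabulate∘lookup; tabulate-cong; lookup∘update; lookup∘update′; lookup-replicate; lookup-map; []=⇒lookup; lookup⇒[]=)
open import Function using (_∘_; id; flip)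
open import Function.Bundles using (_⇔_; mk⇔; Equivalence)
open import Function.Construct.Composition using (_⇔-∘_)
open import Function.Construct.Symmetry using (⇔-sym)
open import Relation.Binary.Definitions using (tri<; tri≈; tri>)
open import Relation.Binary.PropositionalEquality using (_≡_; _≢_; refl; sym; trans; cong; cong₂; subst; module ≡-Reasoning)
open import Relation.Nullary using (¬_; yes; no)

-- The order of burning comes from the arcs. Vertex 0 has one arc to every other vertex. A middle
-- vertex i (0 < i < κ) has one arc to each later vertex and i arcs to vertex 0. A last vertex (i ≥
-- κ) has one arc to each other last vertex and κ arcs to vertex 0. So while vertex 0 is unburnt,
-- the last vertices see only one another and the middle vertices only later ones. Once it has
-- burnt, a middle vertex has n - 1 arcs to burnt vertices as soon as all later ones have burnt,
-- which satisfies every entry up to n; only the last vertices can still obstruct.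
--
-- The equivalence and the count both pass through one predicate, `Burns`, which is evaluated by
-- recursion along the vector. The number r enters in three guises: as the point where the burning
-- of last vertices stalls, as the run of occupied spots after parking, and as the size of the
-- centre of a descending vector. They are identified because each satisfies `IsRun`, which
-- determines r.

true≢false : ∀ {b} → b ≡ true → b ≡ false → ⊥
true≢false refl ()

≤ᵇ-true : ∀ {m n} → m ≤ n → (m ≤ᵇ n) ≡ true
≤ᵇ-true = Equivalence.to T-≡ ∘ ≤⇒≤ᵇ

true-≤ᵇ : ∀ {m n} → (m ≤ᵇ n) ≡ true → m ≤ n
true-≤ᵇ {m} = ≤ᵇ⇒≤ m _ ∘ Equivalence.from T-≡

≤ᵇ-false : ∀ {m n} → n < m → (m ≤ᵇ n) ≡ false
≤ᵇ-false {m} {n} n<m with m ≤ᵇ n in eq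
... | true  = ⊥-elim (<⇒≱ n<m (true-≤ᵇ eq))
... | false = refl

false-≤ᵇ : ∀ {m n} → (m ≤ᵇ n) ≡ false → n < m
false-≤ᵇ eq = ≰⇒> λ m≤n → true≢false (≤ᵇ-true m≤n) eq

≡ᵇ-refl : ∀ n → (n ≡ᵇ n) ≡ true
≡ᵇ-refl n = Equivalence.to T-≡ (≡⇒≡ᵇ n n refl)

true-≡ᵇ : ∀ {m n} → (m ≡ᵇ n) ≡ true → m ≡ n
true-≡ᵇ {m} {n} = ≡ᵇ⇒≡ m n ∘ Equivalence.from T-≡

≡ᵇ-false : ∀ {m n} → m ≢ n → (m ≡ᵇ n) ≡ false
≡ᵇ-false {m} {n} m≢n with m ≡ᵇ n in eq
... | true  = ⊥-elim (m≢n (true-≡ᵇ eq))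
... | false = refl

∧-true : ∀ {b c} → b ∧ c ≡ true → b ≡ true × c ≡ true
∧-true {true} eq = refl , eq

not-true : ∀ {b} → not b ≡ true → b ≡ false
not-true {false} _ = refl

not-false : ∀ {b} → not b ≡ false → b ≡ true
not-false {true} _ = refl

∧-intro : ∀ {b c} → b ≡ true → c ≡ true → b ∧ c ≡ true
∧-intro refl refl = refl

-- Indicators, finite sums and counting

𝟙 : Bool → ℕ
𝟙 b = if b then 1 else 0

𝟙-mono : ∀ {b c} → (b ≡ true → c ≡ true) → 𝟙 b ≤ 𝟙 c
𝟙-mono {false} b⇒c = z≤n
𝟙-mono {true}  b⇒c rewrite b⇒c refl = ≤-refl

𝟙≤1 : ∀ b → 𝟙 b ≤ 1
𝟙≤1 false = z≤n
𝟙≤1 true  = ≤-refl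

sum-zero : ∀ {n} {f : Fin n → ℕ} → (∀ i → f i ≡ 0) → sum f ≡ 0
sum-zero {zero}  f≡0 = refl
sum-zero {suc n} f≡0 rewrite f≡0 zero = sum-zero (f≡0 ∘ suc)

sum-const : ∀ n c → sum {n} (λ _ → c) ≡ n * c
sum-const zero    c = refl
sum-const (suc n) c = cong (c +_) (sum-const n c)

sum-*ʳ : ∀ {n} (f : Fin n → ℕ) c → sum (λ i → f i * c) ≡ sum f * c
sum-*ʳ {zero}  f c = refl
sum-*ʳ {suc n} f c = trans (cong (f zero * c +_) (sum-*ʳ (f ∘ suc) c)) (sym (*-distribʳ-+ c (f zero) _))

suc-≤ᵇ-suc : ∀ κ m → (suc κ ≤ᵇ suc m) ≡ (κ ≤ᵇ m)
suc-≤ᵇ-suc zero    m = refl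
suc-≤ᵇ-suc (suc κ) m = refl

-- Opaque so that unification can recover f from # f.
opaque
  # : ∀ {n} → (Fin n → Bool) → ℕ
  # f = sum (𝟙 ∘ f)

  #-cong : ∀ {n} {f g : Fin n → Bool} → (∀ i → f i ≡ g i) → # f ≡ # g
  #-cong f≗g = sum-cong-≗ (cong 𝟙 ∘ f≗g)

  #-mono : ∀ {n} {f g : Fin n → Bool} → (∀ i → f i ≡ true → g i ≡ true) → # f ≤ # g
  #-mono {zero}  f⇒g = z≤n
  #-mono {suc n} f⇒g = +-mono-≤ (𝟙-mono (f⇒g zero)) (#-mono (f⇒g ∘ suc))

  #-sum : ∀ {n} (f : Fin n → Bool) → # f ≡ sum (𝟙 ∘ f)
  #-sum f = refl

  #-suc : ∀ {n} (f : Fin (suc n) → Bool) → # f ≡ 𝟙 (f zero) + # (f ∘ suc)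
  #-suc f = refl

  #-mono-< : ∀ {n} {f g : Fin n → Bool} → (∀ i → f i ≡ true → g i ≡ true) →
             ∀ i → f i ≡ false → g i ≡ true → # f < # g
  #-mono-< f⇒g zero    fi gi rewrite fi | gi = s≤s (#-mono (f⇒g ∘ suc))
  #-mono-< f⇒g (suc i) fi gi = +-mono-≤-< (𝟙-mono (f⇒g zero)) (#-mono-< (f⇒g ∘ suc) i fi gi)

  #-≥ : ∀ {n} m → m ≤ n → # {n} (λ j → m ≤ᵇ toℕ j) + m ≡ n
  #-≥ {n} zero z≤n = trans (+-identityʳ _) (trans (sum-const n 1) (*-identityʳ n))
  #-≥ {suc n} (suc m) (s≤s m≤n) =
    trans (+-suc _ m) (cong suc (trans (cong (_+ m) (#-cong {n} (suc-≤ᵇ-suc m ∘ toℕ))) (#-≥ {n} m m≤n)))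

sum-single : ∀ {n} {f : Fin n → ℕ} (i : Fin n) → (∀ j → j ≢ i → f j ≡ 0) → sum f ≡ f i
sum-single {f = f} zero    f≡0 = trans (cong (f zero +_) (sum-zero λ j → f≡0 (suc j) λ ())) (+-identityʳ _)
sum-single {f = f} (suc i) f≡0 rewrite f≡0 zero (λ ()) =
  sum-single {f = f ∘ suc} i λ j j≢i → f≡0 (suc j) λ { refl → j≢i refl }

-- Sums over lists

lsum : {A : Set} → (A → ℕ) → List A → ℕ
lsum f []       = 0
lsum f (x ∷ xs) = f x + lsum f xs

lsum-++ : {A : Set} (f : A → ℕ) (xs ys : List A) → lsum f (xs ++ ys) ≡ lsum f xs + lsum f ys
lsum-++ f []       ys = refl
lsum-++ f (x ∷ xs) ys = trans (cong (f x +_) (lsum-++ f xs ys)) (sym (+-assoc (f x) _ _))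

lsum-concatMap : {A B : Set} (f : B → ℕ) (g : A → List B) (xs : List A) →
                 lsum f (concatMap g xs) ≡ lsum (lsum f ∘ g) xs
lsum-concatMap f g []       = refl
lsum-concatMap f g (x ∷ xs) =
  trans (lsum-++ f (g x) (concatMap g xs)) (cong (lsum f (g x) +_) (lsum-concatMap f g xs))

lsum-map : {A B : Set} (f : B → ℕ) (g : A → B) (xs : List A) → lsum f (map g xs) ≡ lsum (f ∘ g) xs
lsum-map f g []       = refl
lsum-map f g (x ∷ xs) = cong (f (g x) +_) (lsum-map f g xs)

lsum-tabulate : {A : Set} (f : A → ℕ) {n : ℕ} (g : Fin n → A) →
                lsum f (Vec.toList (tabulate g)) ≡ sum (f ∘ g)
lsum-tabulate f {zero}  g = refl
lsum-tabulate f {suc n} g = cong (f (g zero) +_) (lsum-tabulate f (g ∘ suc))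

lsum-finList : ∀ {n} (f : Fin n → ℕ) → lsum f (finList n) ≡ sum f
lsum-finList f = lsum-tabulate f id

length-filterᵇ : {A : Set} (p : A → Bool) (xs : List A) → length (filterᵇ p xs) ≡ lsum (𝟙 ∘ p) xs
length-filterᵇ p []       = refl
length-filterᵇ p (x ∷ xs) with p x
... | true  = cong suc (length-filterᵇ p xs)
... | false = length-filterᵇ p xs

lsum-if-singleton : {A : Set} (f : A → ℕ) (b : Bool) (x : A) →
                    lsum f (if b then [ x ] else []) ≡ 𝟙 b * f x
lsum-if-singleton f true  x = refl
lsum-if-singleton f false x = refl

lsum-if : {A : Set} (f : A → ℕ) (b : Bool) (xs : List A) →
          lsum f (if b then xs else []) ≡ 𝟙 b * lsum f xs
lsum-if f true  xs = sym (+-identityʳ _)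
lsum-if f false xs = refl

-- Out-degrees

suc-⊓ : ∀ m κ → m ⊓ κ + 𝟙 (m <ᵇ κ) ≡ suc m ⊓ κ
suc-⊓ m κ with m <ᵇ κ in eq
... | true  rewrite m≤n⇒m⊓n≡m (<⇒≤ (true-≤ᵇ {suc m} {κ} eq)) | m≤n⇒m⊓n≡m (true-≤ᵇ {suc m} {κ} eq) = +-comm m 1
... | false with s≤s κ≤m ← false-≤ᵇ {suc m} {κ} eq
  rewrite m≥n⇒m⊓n≡n κ≤m | m≥n⇒m⊓n≡n (m≤n⇒m≤1+n κ≤m) = +-identityʳ κ

module _ {n : ℕ} (p : Arc n → Bool) where

  weight : Hyperplane n → ℕ
  weight h = 𝟙 (p (hypArc h))

  -- All shifts c of one pair (i , j) give the same arc (j , i), and of the candidates 1, ..., m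
  -- only those up to κ are kept; hence the multiplicity m ⊓ κ.
  shifted-weight : ∀ κ (i j : Fin n) m →
    lsum weight (concatMap (λ c → if c <ᵇ suc κ then [ hyp i j c ] else []) (map suc (upTo m)))
      ≡ (m ⊓ κ) * 𝟙 (p (j , i))
  shifted-weight κ i j m =
    trans (lsum-concatMap weight _ (map suc (upTo m))) (trans (lsum-map _ suc (upTo m)) (go m))
    where
    f : ℕ → ℕ
    f c = lsum weight (if suc c <ᵇ suc κ then [ hyp i j (suc c) ] else [])
    w = 𝟙 (p (j , i))
    go : ∀ m → lsum f (upTo m) ≡ (m ⊓ κ) * w
    go zero    = refl
    go (suc m) = begin
      lsum f (upTo (suc m))             ≡⟨ cong (lsum f) (upTo-∷ʳ m) ⟨
      lsum f (upTo m ∷ʳ m)              ≡⟨ lsum-++ f (upTo m) _ ⟩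
      lsum f (upTo m) + (f m + 0)       ≡⟨ cong₂ _+_ (go m) (trans (+-identityʳ _) (lsum-if-singleton weight (m <ᵇ κ) _)) ⟩
      (m ⊓ κ) * w + 𝟙 (m <ᵇ κ) * w      ≡⟨ *-distribʳ-+ w (m ⊓ κ) _ ⟨
      (m ⊓ κ + 𝟙 (m <ᵇ κ)) * w          ≡⟨ cong (_* w) (suc-⊓ m κ) ⟩
      (suc m ⊓ κ) * w ∎
      where open ≡-Reasoning

-- One summand for each family of hyperplanes: this one for x_i = x_j, `toOne` for x_1 = x_j + c and
-- `backward` for x_i = x_j + 1. In the last two the arc runs from the larger index to the smaller.
forward : ∀ {n} → Subset n → Fin n → Fin n → ℕ
forward I i j = 𝟙 ((toℕ i <ᵇ toℕ j) ∧ not (lookup I j))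

toOne backward : ∀ {n} → ℕ → Subset n → Fin n → Fin n → ℕ
toOne    κ I i j = 𝟙 ((toℕ j ≡ᵇ 0) ∧ (toℕ j <ᵇ toℕ i)) * ((toℕ i ⊓ κ) * 𝟙 (not (lookup I j)))
backward κ I i j = 𝟙 ((κ ≤ᵇ toℕ j) ∧ (toℕ j <ᵇ toℕ i)) * 𝟙 (not (lookup I j))

𝟙-*-zero : ∀ b m → m ≡ 0 → 𝟙 b * m ≡ 0
𝟙-*-zero b m refl = *-zeroʳ (𝟙 b)

outDeg-formula : ∀ {n} κ (I : Subset n) (i : Fin n) →
  outDeg (graphG n (suc κ)) I i ≡ sum (forward I i) + (sum (toOne κ I i) + sum (backward κ I i))
outDeg-formula {n} κ I i = begin
  outDeg (graphG n (suc κ)) I i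
    ≡⟨ trans (length-filterᵇ p (graphG n (suc κ))) (lsum-map (𝟙 ∘ p) hypArc (arrangement n (suc κ))) ⟩
  lsum (weight p) (arrangement n (suc κ))
    ≡⟨ trans (lsum-concatMap (weight p) _ (finList n)) (lsum-finList {n} _) ⟩
  sum (λ x → lsum (weight p) (concatMap (block x) (finList n)))
    ≡⟨ sum-cong-≗ (λ x → trans (lsum-concatMap (weight p) (block x) (finList n))
                          (trans (lsum-finList {n} _) (sum-cong-≗ (block-weight x)))) ⟩
  sum (λ x → sum (λ y → F x y + (O x y + B x y)))
    ≡⟨ sum-cong-≗ (λ x → trans (∑-distrib-+ (F x) _) (cong (sum (F x) +_) (∑-distrib-+ (O x) (B x)))) ⟩
  sum (λ x → sum (F x) + (sum (O x) + sum (B x)))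
    ≡⟨ trans (∑-distrib-+ (sum ∘ F) _) (cong (sum (sum ∘ F) +_) (∑-distrib-+ (sum ∘ O) (sum ∘ B))) ⟩
  sum (sum ∘ F) + (sum (sum ∘ O) + sum (sum ∘ B))
    -- A forward arc starts at the outer index `x`, the other arcs at the inner index `y`. So the
    -- outer sum collapses to `i` in the first term and the inner sums collapse in the other two.
    ≡⟨ cong₂ _+_
         (trans (sum-single i λ x x≢i → sum-zero λ y → F≡0 x y x≢i) (sum-cong-≗ F≡forward))
         (cong₂ _+_
           (sum-cong-≗ λ x → trans (sum-single i (O≡0 x)) (O≡toOne x))
           (sum-cong-≗ λ x → trans (sum-single i (B≡0 x)) (B≡backward x))) ⟩
  sum (forward I i) + (sum (toOne κ I i) + sum (backward κ I i)) ∎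
  where
  open ≡-Reasoning
  p : Arc n → Bool
  p e = (toℕ (proj₁ e) ≡ᵇ toℕ i) ∧ not (lookup I (proj₂ e))
  block : Fin n → Fin n → List (Hyperplane n)
  block x y =
      (if label x <ᵇ label y then [ hyp x y 0 ] else [])
   ++ (if (label x ≡ᵇ 1) ∧ (label x <ᵇ label y)
         then concatMap (λ c → if c <ᵇ suc κ then [ hyp x y c ] else []) (map suc (upTo (toℕ y)))
         else [])
   ++ (if (suc κ ≤ᵇ label x) ∧ (label x <ᵇ label y) then [ hyp x y 1 ] else [])
  F O B : Fin n → Fin n → ℕ
  F x y = 𝟙 (toℕ x <ᵇ toℕ y) * 𝟙 (p (x , y))
  O x y = 𝟙 ((toℕ x ≡ᵇ 0) ∧ (toℕ x <ᵇ toℕ y)) * ((toℕ y ⊓ κ) * 𝟙 (p (y , x)))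
  B x y = 𝟙 ((κ ≤ᵇ toℕ x) ∧ (toℕ x <ᵇ toℕ y)) * 𝟙 (p (y , x))
  block-weight : ∀ x y → lsum (weight p) (block x y) ≡ F x y + (O x y + B x y)
  block-weight x y =
    trans (lsum-++ (weight p) (if label x <ᵇ label y then [ hyp x y 0 ] else []) _)
      (cong₂ _+_ (lsum-if-singleton (weight p) (toℕ x <ᵇ toℕ y) _)
        (trans (lsum-++ (weight p) (if (label x ≡ᵇ 1) ∧ (label x <ᵇ label y) then _ else []) _)
          (cong₂ _+_
            (trans (lsum-if (weight p) ((label x ≡ᵇ 1) ∧ (label x <ᵇ label y)) _)
                   (cong (𝟙 ((toℕ x ≡ᵇ 0) ∧ (toℕ x <ᵇ toℕ y)) *_) (shifted-weight p κ x y (toℕ y))))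
            (trans (lsum-if-singleton (weight p) ((suc κ ≤ᵇ label x) ∧ (label x <ᵇ label y)) _)
                   (cong (λ b → 𝟙 (b ∧ (toℕ x <ᵇ toℕ y)) * 𝟙 (p (y , x))) (suc-≤ᵇ-suc κ (toℕ x)))))))
  p≡false : ∀ {x} y → x ≢ i → p (x , y) ≡ false
  p≡false y x≢i rewrite ≡ᵇ-false (x≢i ∘ toℕ-injective) = refl
  p-self : ∀ y → p (i , y) ≡ not (lookup I y)
  p-self y rewrite ≡ᵇ-refl (toℕ i) = refl
  F≡0 : ∀ x y → x ≢ i → F x y ≡ 0
  F≡0 x y x≢i = 𝟙-*-zero (toℕ x <ᵇ toℕ y) _ (cong 𝟙 (p≡false y x≢i))
  F≡forward : ∀ y → F i y ≡ forward I i y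
  F≡forward y rewrite p-self y with toℕ i <ᵇ toℕ y
  ... | true  = *-identityˡ _
  ... | false = refl
  O≡0 : ∀ x y → y ≢ i → O x y ≡ 0
  O≡0 x y y≢i = 𝟙-*-zero ((toℕ x ≡ᵇ 0) ∧ _) _
    (trans (cong (toℕ y ⊓ κ *_) (cong 𝟙 (p≡false x y≢i))) (*-zeroʳ (toℕ y ⊓ κ)))
  O≡toOne : ∀ x → O x i ≡ toOne κ I i x
  O≡toOne x rewrite p-self x = refl
  B≡0 : ∀ x y → y ≢ i → B x y ≡ 0
  B≡0 x y y≢i = 𝟙-*-zero ((κ ≤ᵇ toℕ x) ∧ _) _ (cong 𝟙 (p≡false x y≢i))
  B≡backward : ∀ x → B x i ≡ backward κ I i x
  B≡backward x rewrite p-self x = refl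

find-true : ∀ {n} (f : Fin n → Bool) → (∃ λ i → f i ≡ true) ⊎ (∀ i → f i ≡ false)
find-true {zero}  f = inj₂ λ ()
find-true {suc n} f with f zero in eq | find-true (f ∘ suc)
... | true  | _            = inj₁ (zero , eq)
... | false | inj₁ (i , p) = inj₁ (suc i , p)
... | false | inj₂ none    = inj₂ λ { zero → eq ; (suc i) → none i }

trisect : ∀ {n} κ (i : Fin (suc n)) → i ≡ zero ⊎ (0 < toℕ i × toℕ i < κ) ⊎ κ ≤ toℕ i
trisect κ zero    = inj₁ refl
trisect κ (suc i) with κ ≤? suc (toℕ i)
... | yes κ≤i = inj₂ (inj₂ κ≤i)
... | no  κ≰i = inj₂ (inj₁ (z<s , ≰⇒> κ≰i))

outsideFrom : ∀ {n} → ℕ → Subset n → ℕ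
outsideFrom m I = # (λ j → (m ≤ᵇ toℕ j) ∧ not (lookup I j))

module _ {n : ℕ} (κ : ℕ) (I : Subset (suc n)) where

  private
    deg : Fin (suc n) → ℕ
    deg = outDeg (graphG (suc n) (suc κ)) I

  sum-toOne : ∀ i → 0 < toℕ i → sum (toOne κ I i) ≡ (toℕ i ⊓ κ) * 𝟙 (not (lookup I zero))
  sum-toOne (suc i) _ = trans (sum-single {f = toOne κ I (suc i)} zero λ { zero z≢z → ⊥-elim (z≢z refl) ; (suc j) _ → refl }) (+-identityʳ _)

  outDeg-first : deg zero ≡ outsideFrom 1 I
  outDeg-first = trans (outDeg-formula κ I zero) (trans (cong₂ _+_ (sym (#-sum _))
    (cong₂ _+_ (sum-zero {f = toOne κ I zero} toOne≡0) (sum-zero {f = backward κ I zero} backward≡0)))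
    (+-identityʳ _))
    where
    toOne≡0 : ∀ j → toOne κ I zero j ≡ 0
    toOne≡0 zero    = refl
    toOne≡0 (suc j) = refl
    backward≡0 : ∀ j → backward κ I zero j ≡ 0
    backward≡0 j rewrite ∧-zeroʳ (κ ≤ᵇ toℕ j) = refl

  outDeg-middle : ∀ i → 0 < toℕ i → toℕ i < κ → deg i ≡ outsideFrom (suc (toℕ i)) I + toℕ i * 𝟙 (not (lookup I zero))
  outDeg-middle i 0<i i<κ = trans (outDeg-formula κ I i) (cong₂ _+_ (sym (#-sum _)) (trans
    (cong₂ _+_ (sum-toOne i 0<i) (sum-zero {f = backward κ I i} backward≡0)) (trans (+-identityʳ _)
    (cong (_* 𝟙 (not (lookup I zero))) (m≤n⇒m⊓n≡m (<⇒≤ i<κ))))))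
    where
    backward≡0 : ∀ j → backward κ I i j ≡ 0
    backward≡0 j with κ ≤ᵇ toℕ j in κ≤j
    ... | false = refl
    ... | true rewrite ≤ᵇ-false {suc (toℕ j)} {toℕ i} (s≤s (≤-trans (<⇒≤ i<κ) (true-≤ᵇ κ≤j))) = refl

  -- Forward arcs reach the later last vertices and backward arcs the earlier ones, so together they
  -- reach every other last vertex exactly once. Letting `j` range over `i` too is harmless because
  -- `i` lies in `I`.
  outDeg-last : ∀ i → 0 < κ → κ ≤ toℕ i → lookup I i ≡ true →
                deg i ≡ outsideFrom κ I + κ * 𝟙 (not (lookup I zero))
  outDeg-last i 0<κ κ≤i i∈I = begin
    deg i                                     ≡⟨ outDeg-formula κ I i ⟩
    F + (O + B)                               ≡⟨ cong (F +_) (+-comm O B) ⟩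
    F + (B + O)                               ≡⟨ +-assoc F B O ⟨
    F + B + O
      ≡⟨ cong₂ _+_ (trans (sym (∑-distrib-+ (forward I i) (backward κ I i))) (trans (sum-cong-≗ merge) (sym (#-sum _))))
                                                   (trans (sum-toOne i (≤-trans 0<κ κ≤i)) (cong (_* _) (m≥n⇒m⊓n≡n κ≤i))) ⟩
    outsideFrom κ I + κ * 𝟙 (not (lookup I zero)) ∎
    where
    open ≡-Reasoning
    F = sum (forward I i)
    O = sum (toOne κ I i)
    B = sum (backward κ I i)
    merge : ∀ j → forward I i j + backward κ I i j ≡ 𝟙 ((κ ≤ᵇ toℕ j) ∧ not (lookup I j))
    merge j with <-cmp (toℕ i) (toℕ j)
    ... | tri< i<j _ _ rewrite ≤ᵇ-true i<j | ≤ᵇ-false {suc (toℕ j)} {toℕ i} (s≤s (<⇒≤ i<j))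
                             | ≤ᵇ-true (≤-trans κ≤i (<⇒≤ i<j)) = +-identityʳ _
    ... | tri> _ _ j<i rewrite ≤ᵇ-false {suc (toℕ i)} {toℕ j} (s≤s (<⇒≤ j<i)) | ≤ᵇ-true j<i with κ ≤ᵇ toℕ j
    ...   | true  = *-identityˡ _
    ...   | false = refl
    merge j | tri≈ _ i≡j _ with refl ← toℕ-injective i≡j
      rewrite i∈I | ∧-zeroʳ (toℕ i <ᵇ toℕ i) | ∧-zeroʳ (κ ≤ᵇ toℕ i) = *-zeroʳ (𝟙 ((κ ≤ᵇ toℕ i) ∧ (toℕ i <ᵇ toℕ i)))

  -- This is what keeps the entries of a G-parking function in range. A middle vertex trades the
  -- vertices before it for arcs to vertex 0, one for one; for a last vertex the bound is strict
  -- because `i` itself is not outside `I`.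
  outDeg< : ∀ i → 0 < κ → κ ≤ n → lookup I i ≡ true → deg i < suc n
  outDeg< i 0<κ κ≤n i∈I with trisect κ i
  ... | inj₁ refl = s≤s (begin
    deg zero                          ≡⟨ outDeg-first ⟩
    outsideFrom 1 I                        ≤⟨ #-mono (λ j → proj₁ ∘ ∧-true) ⟩
    # {suc n} (λ j → 1 ≤ᵇ toℕ j)      ≡⟨ suc-injective (trans (+-comm 1 _) (#-≥ {suc n} 1 (s≤s z≤n))) ⟩
    n                                 ∎)
    where open ≤-Reasoning
  ... | inj₂ (inj₁ (0<i , i<κ)) = begin-strict
    deg i                                         ≡⟨ outDeg-middle i 0<i i<κ ⟩
    outsideFrom (suc (toℕ i)) I + toℕ i * 𝟙 (not (lookup I zero))
      ≤⟨ +-mono-≤ (#-mono λ j → proj₁ ∘ ∧-true) (*-monoʳ-≤ (toℕ i) (𝟙≤1 (not (lookup I zero)))) ⟩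
    # {suc n} (λ j → suc (toℕ i) ≤ᵇ toℕ j) + toℕ i * 1  ≡⟨ cong (# {suc n} (λ j → suc (toℕ i) ≤ᵇ toℕ j) +_) (*-identityʳ _) ⟩
    # {suc n} (λ j → suc (toℕ i) ≤ᵇ toℕ j) + toℕ i      <⟨ +-monoʳ-< (# {suc n} (λ j → suc (toℕ i) ≤ᵇ toℕ j)) ≤-refl ⟩
    # {suc n} (λ j → suc (toℕ i) ≤ᵇ toℕ j) + suc (toℕ i) ≡⟨ #-≥ (suc (toℕ i)) (toℕ<n i) ⟩
    suc n                                         ∎
    where open ≤-Reasoning
  ... | inj₂ (inj₂ κ≤i) = begin-strict
    deg i                                         ≡⟨ outDeg-last i 0<κ κ≤i i∈I ⟩
    outsideFrom κ I + κ * 𝟙 (not (lookup I zero))     ≤⟨ +-monoʳ-≤ (outsideFrom κ I) (*-monoʳ-≤ κ (𝟙≤1 (not (lookup I zero)))) ⟩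
    outsideFrom κ I + κ * 1                           ≡⟨ cong (outsideFrom κ I +_) (*-identityʳ κ) ⟩
    outsideFrom κ I + κ
      <⟨ +-monoˡ-< κ (#-mono-< (λ j → proj₁ ∘ ∧-true) i not-counted (≤ᵇ-true κ≤i)) ⟩
    # {suc n} (λ j → κ ≤ᵇ toℕ j) + κ              ≡⟨ #-≥ κ (m≤n⇒m≤1+n κ≤n) ⟩
    suc n                                         ∎
    where
    open ≤-Reasoning
    not-counted : (κ ≤ᵇ toℕ i) ∧ not (lookup I i) ≡ false
    not-counted rewrite i∈I = ∧-zeroʳ (κ ≤ᵇ toℕ i)

-- Burning

-- The second component says that q ≤ c(q) fails at q = r + 1, so `r` is determined by `c`. This
-- lets values of r that were computed in unrelated ways be identified.
IsRun : (ℕ → ℕ) → ℕ → Set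
IsRun c r = (∀ q → q ≤ r → q ≤ c q) × c (suc r) ≤ r

countFrom : ∀ {n} → ℕ → Vec ℕ n → ℕ → ℕ
countFrom κ a q = # (λ i → (κ ≤ᵇ toℕ i) ∧ (lookup a i ≤ᵇ q))

ParkingBound : ∀ {n} → ℕ → Vec ℕ n → Set
ParkingBound {n} κ a = ∀ q → q ≤ n → q ≤ countFrom κ a q + κ

-- `J` is the set of vertices burnt before vertex 0. It is described by equations instead of a
-- process: before vertex 0 burns, a middle vertex depends only on later vertices, so the equations
-- already determine `J` from the top down.
record IsBurnt {n : ℕ} (κ : ℕ) (a : Vec ℕ (suc n)) (r : ℕ) (J : Fin (suc n) → Bool) : Set where
  field
    isRun       : IsRun (countFrom κ a) r
    burn-first  : J zero ≡ false
    burn-middle : ∀ i → 0 < toℕ i → toℕ i < κ →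
                  J i ≡ (lookup a i ≤ᵇ suc (# λ j → (toℕ i <ᵇ toℕ j) ∧ J j))
    burn-last   : ∀ i → κ ≤ toℕ i → J i ≡ (lookup a i ≤ᵇ suc r)

module _ {n κ : ℕ} (0<κ : 0 < κ) (κ≤n : κ ≤ n) (a : Vec ℕ (suc n))
         {r : ℕ} {J : Fin (suc n) → Bool} (burnt : IsBurnt κ a r J) where

  open IsBurnt burnt

  private
    G = graphG (suc n) (suc κ)
    c = countFrom κ a

    #≥κ : # {suc n} (λ j → κ ≤ᵇ toℕ j) + κ ≡ suc n
    #≥κ = #-≥ κ (m≤n⇒m≤1+n κ≤n)

    <+2⇒≤suc : ∀ {x m d} → x < m + 2 → m ≤ d → x ≤ suc d
    <+2⇒≤suc {x} {m} {d} x<m<+2⇒≤suc m≤d = ≤-pred (≤-trans x<m<+2⇒≤suc (≤-trans (+-monoˡ-≤ 2 m≤d) (≤-reflexive (+-comm d 2))))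

  module _ (park : IsGParking G a) where

    -- Test the condition on the singleton of `i`: the witness must be `i`, and its out-degree is
    -- smaller than the number of vertices.
    gparking⇒range : InRange a
    gparking⇒range i = proj₁ park i , upper
      where
      I : Subset (suc n)
      I = tabulate (λ j → toℕ i ≡ᵇ toℕ j)
      i∈I : lookup I i ≡ true
      i∈I = trans (lookup∘tabulate (λ j → toℕ i ≡ᵇ toℕ j) i) (≡ᵇ-refl (toℕ i))
      upper : lookup a i ≤ suc n
      upper with proj₂ park I (i , lookup⇒[]= i I i∈I)
      ... | j , j∈I , a<deg with refl ← toℕ-injective (true-≡ᵇ {toℕ i} {toℕ j}
              (trans (sym (lookup∘tabulate (λ j → toℕ i ≡ᵇ toℕ j) j)) ([]=⇒lookup j∈I))) =
        ≤-trans (<+2⇒≤suc a<deg ≤-refl) (outDeg< κ I i 0<κ κ≤n i∈I)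

    -- Test the condition on the last vertices with an entry above q. From any of them, the arcs
    -- that leave this set lead to the c(q) other last vertices or are among the κ arcs to vertex 0.
    gparking⇒bound : ParkingBound κ a
    gparking⇒bound q q≤n = ≮⇒≥ impossible
      where
      f : Fin (suc n) → Bool
      f i = (κ ≤ᵇ toℕ i) ∧ not (lookup a i ≤ᵇ q)
      I = tabulate f
      lookup-I : ∀ i → lookup I i ≡ f i
      lookup-I = lookup∘tabulate f
      impossible : ¬ (c q + κ < q)
      impossible c+κ<q with find-true f
      -- The test set is empty: c(q) counts all last vertices, and c(q) + κ is at least the number
      -- of vertices.
      ... | inj₂ none = <⇒≱ c+κ<q (≤-trans q≤n (≤-trans (≤-reflexive (sym #≥κ)) (+-monoˡ-≤ κ (#-mono small))))
        where
        small : ∀ i → (κ ≤ᵇ toℕ i) ≡ true → (κ ≤ᵇ toℕ i) ∧ (lookup a i ≤ᵇ q) ≡ true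
        small i κ≤i with none i
        ... | none-i rewrite κ≤i = not-false none-i
      ... | inj₁ (i₀ , fi₀) with proj₂ park I (i₀ , lookup⇒[]= i₀ I (trans (lookup-I i₀) fi₀))
      ...   | i , i∈I , a<deg with ∧-true {κ ≤ᵇ toℕ i} (trans (sym (lookup-I i)) ([]=⇒lookup i∈I))
      ...     | κ≤i , a≰q = <⇒≱ (false-≤ᵇ {lookup a i} {q} (not-true a≰q)) (begin
        lookup a i      ≤⟨ <+2⇒≤suc a<deg deg≤ ⟩
        suc (c q + κ)   ≤⟨ c+κ<q ⟩
        q               ∎)
        where
        open ≤-Reasoning
        outside : ∀ j → (κ ≤ᵇ toℕ j) ∧ not (lookup I j) ≡ true → (κ ≤ᵇ toℕ j) ∧ (lookup a j ≤ᵇ q) ≡ true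
        outside j out rewrite lookup-I j with κ ≤ᵇ toℕ j | lookup a j ≤ᵇ q
        ... | true | true = refl
        deg≤ : outDeg G I i ≤ c q + κ
        deg≤ = begin
          outDeg G I i                                    ≡⟨ outDeg-last κ I i 0<κ (true-≤ᵇ κ≤i) ([]=⇒lookup i∈I) ⟩
          outsideFrom κ I + κ * 𝟙 (not (lookup I zero))
            ≤⟨ +-mono-≤ (#-mono outside) (*-monoʳ-≤ κ (𝟙≤1 (not (lookup I zero)))) ⟩
          c q + κ * 1                                     ≡⟨ cong (c q +_) (*-identityʳ κ) ⟩
          c q + κ                                         ∎

    -- Test the condition on the set of unburnt vertices. A middle or last witness would have enough
    -- arcs to burnt vertices to burn itself, so the witness is vertex 0.
    gparking⇒first : lookup a zero ≤ suc (# J)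
    gparking⇒first = from-witness (proj₂ park I (zero , lookup⇒[]= zero I (trans (lookup-I zero) (cong not burn-first))))
      where
      I : Subset (suc n)
      I = tabulate (not ∘ J)
      lookup-I : ∀ i → lookup I i ≡ not (J i)
      lookup-I = lookup∘tabulate (not ∘ J)
      outside : ∀ j → not (lookup I j) ≡ J j
      outside j = trans (cong not (lookup-I j)) (not-involutive (J j))
      outside-first : ∀ m → m * 𝟙 (not (lookup I zero)) ≡ 0
      outside-first m = trans (cong (λ b → m * 𝟙 b) (trans (outside zero) burn-first)) (*-zeroʳ m)
      unburnt : ∀ {i} → i ∈ₛ I → J i ≡ false
      unburnt {i} i∈I = not-true (trans (sym (lookup-I i)) ([]=⇒lookup i∈I))
      from-witness : (∃ λ i → (i ∈ₛ I) × (lookup a i < outDeg G I i + 2)) → lookup a zero ≤ suc (# J)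
      from-witness (i , i∈I , a<deg) with trisect κ i
      ... | inj₁ refl = <+2⇒≤suc a<deg (begin
        outDeg G I zero       ≡⟨ outDeg-first κ I ⟩
        outsideFrom 1 I        ≤⟨ #-mono (λ j out → trans (sym (outside j)) (proj₂ (∧-true out))) ⟩
        # J                   ∎)
        where open ≤-Reasoning
      ... | inj₂ (inj₁ (0<i , i<κ)) = ⊥-elim (true≢false (trans (burn-middle i 0<i i<κ) (≤ᵇ-true (<+2⇒≤suc a<deg deg≤))) (unburnt i∈I))
        where
        deg≤ : outDeg G I i ≤ # (λ j → (toℕ i <ᵇ toℕ j) ∧ J j)
        deg≤ = ≤-reflexive (trans (outDeg-middle κ I i 0<i i<κ)
          (trans (cong₂ _+_ (#-cong λ j → cong ((toℕ i <ᵇ toℕ j) ∧_) (outside j)) (outside-first (toℕ i))) (+-identityʳ _)))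
      ... | inj₂ (inj₂ κ≤i) = ⊥-elim (true≢false (trans (burn-last i κ≤i) (≤ᵇ-true (<+2⇒≤suc a<deg deg≤))) (unburnt i∈I))
        where
        counted : ∀ j → (κ ≤ᵇ toℕ j) ∧ not (lookup I j) ≡ true → (κ ≤ᵇ toℕ j) ∧ (lookup a j ≤ᵇ suc r) ≡ true
        counted j out with κ≤j , j∉I ← ∧-true {κ ≤ᵇ toℕ j} out =
          ∧-intro κ≤j (trans (sym (burn-last j (true-≤ᵇ κ≤j))) (trans (sym (outside j)) j∉I))
        deg≤ : outDeg G I i ≤ r
        deg≤ = begin
          outDeg G I i                                   ≡⟨ outDeg-last κ I i 0<κ κ≤i ([]=⇒lookup i∈I) ⟩
          outsideFrom κ I + κ * 𝟙 (not (lookup I zero))  ≡⟨ cong (outsideFrom κ I +_) (outside-first κ) ⟩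
          outsideFrom κ I + 0                            ≡⟨ +-identityʳ _ ⟩
          outsideFrom κ I                                ≤⟨ #-mono counted ⟩
          c (suc r)                                      ≤⟨ proj₂ isRun ⟩
          r                                              ∎
          where open ≤-Reasoning

  module _ (range : InRange a) (bound : ParkingBound κ a) (first : lookup a zero ≤ suc (# J)) where

    private module _ (I : Subset (suc n)) (stuck : ∀ i → lookup I i ≡ true → outDeg G I i + 2 ≤ lookup a i) where

      m = outsideFrom κ I

      contra : ∀ {i d} → lookup I i ≡ true → d ≤ outDeg G I i → lookup a i ≤ suc d → ⊥
      contra {i} {d} i∈I d≤deg a≤ = <⇒≱ (≤-trans (≤-reflexive (+-comm 2 d)) (≤-trans (+-monoˡ-≤ 2 d≤deg) (stuck i i∈I))) a≤

      -- Strong induction from the largest index down, since a middle vertex is settled by the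
      -- vertices after it.
      descend : (P : Fin (suc n) → Set) → (∀ i → (∀ j → toℕ i < toℕ j → P j) → P i) → ∀ i → P i
      descend P step i = go (suc n) i (m≤n⇒m≤o+n (toℕ i) ≤-refl)
        where
        go : ∀ d i → suc n ≤ toℕ i + d → P i
        go zero    i n<i = ⊥-elim (<⇒≱ (toℕ<n i) (≤-trans n<i (≤-reflexive (+-identityʳ _))))
        go (suc d) i n<i = step i λ j i<j → go d j (≤-trans n<i (≤-trans (≤-reflexive (+-suc (toℕ i) d)) (+-monoˡ-≤ d i<j)))

      module First∈I (0∈I : lookup I zero ≡ true) where

        m≤deg : ∀ {i} → κ ≤ toℕ i → lookup I i ≡ true → m ≤ outDeg G I i
        m≤deg {i} κ≤i i∈I = ≤-trans (m≤m+n m _) (≤-reflexive (sym (outDeg-last κ I i 0<κ κ≤i i∈I)))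

        small⇒outside : ∀ j → (κ ≤ᵇ toℕ j) ∧ (lookup a j ≤ᵇ suc m) ≡ true → (κ ≤ᵇ toℕ j) ∧ not (lookup I j) ≡ true
        small⇒outside j small with κ≤j , a≤ ← ∧-true {κ ≤ᵇ toℕ j} small with lookup I j in j∈I
        ... | true  = ⊥-elim (contra j∈I (m≤deg (true-≤ᵇ κ≤j) j∈I) (true-≤ᵇ a≤))
        ... | false = ∧-intro κ≤j refl

        -- A last vertex with entry at most m + 1 cannot be stuck in `I`, so c(m + 1) ≤ m; but m < r
        -- would give m + 1 ≤ c(m + 1). Hence every burnt last vertex, having an entry at most r +
        -- 1, lies outside `I`.
        r≤m : r ≤ m
        r≤m = ≮⇒≥ λ m<r → <⇒≱ (proj₁ isRun (suc m) m<r) (#-mono small⇒outside)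

        burnt⇒outside : ∀ i → J i ≡ true → lookup I i ≡ false
        burnt⇒outside = descend _ step
          where
          step : ∀ i → (∀ j → toℕ i < toℕ j → J j ≡ true → lookup I j ≡ false) → J i ≡ true → lookup I i ≡ false
          step i ih Ji with lookup I i in i∈I
          ... | false = refl
          ... | true with trisect κ i
          ...   | inj₁ refl = ⊥-elim (true≢false Ji burn-first)
          ...   | inj₂ (inj₂ κ≤i) = ⊥-elim (contra i∈I (m≤deg κ≤i i∈I)
                    (≤-trans (true-≤ᵇ (trans (sym (burn-last i κ≤i)) Ji)) (s≤s r≤m)))
          ...   | inj₂ (inj₁ (0<i , i<κ)) = ⊥-elim (contra i∈I
                    (≤-trans (#-mono λ j iJ → let i<j , Jj = ∧-true {toℕ i <ᵇ toℕ j} iJ in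
                                              ∧-intro i<j (cong not (ih j (true-≤ᵇ i<j) Jj)))
                      (≤-trans (m≤m+n (outsideFrom (suc (toℕ i)) I) _) (≤-reflexive (sym (outDeg-middle κ I i 0<i i<κ)))))
                    (true-≤ᵇ (trans (sym (burn-middle i 0<i i<κ)) Ji)))

        absurd : ⊥
        absurd = contra 0∈I (≤-trans (#-mono burnt⇒positive) (≤-reflexive (sym (outDeg-first κ I)))) first
          where
          burnt⇒positive : ∀ j → J j ≡ true → (0 <ᵇ toℕ j) ∧ not (lookup I j) ≡ true
          burnt⇒positive zero    J0 = ⊥-elim (true≢false J0 burn-first)
          burnt⇒positive (suc j) Jj = cong not (burnt⇒outside (suc j) Jj)

      module First∉I (0∉I : lookup I zero ≡ false) where

        -- With vertex 0 outside, each last vertex of `I` has m + κ arcs leaving `I`, so last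
        -- vertices with entry at most m + κ + 1 lie outside `I` and number at most m. The parking
        -- bound at q = m + κ + 1 demands m + 1 of them; this q is admissible because `i` itself is
        -- a last vertex not counted in m.
        last∉I : ∀ i → κ ≤ toℕ i → lookup I i ≡ true → ⊥
        last∉I i κ≤i i∈I = <⇒≱ (+-cancelʳ-≤ κ (suc m) _ (bound (suc (m + κ)) m+κ<)) (#-mono small⇒outside)
          where
          m+κ< : m + κ < suc n
          m+κ< = ≤-trans (+-monoˡ-< κ (#-mono-< (λ j → proj₁ ∘ ∧-true) i
                   (trans (cong (λ b → (κ ≤ᵇ toℕ i) ∧ not b) i∈I) (∧-zeroʳ _)) (≤ᵇ-true κ≤i))) (≤-reflexive #≥κ)
          deg : ∀ {j} → κ ≤ toℕ j → lookup I j ≡ true → m + κ ≤ outDeg G I j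
          deg {j} κ≤j j∈I = ≤-reflexive (sym (trans (outDeg-last κ I j 0<κ κ≤j j∈I)
            (cong (m +_) (trans (cong (λ b → κ * 𝟙 (not b)) 0∉I) (*-identityʳ κ)))))
          small⇒outside : ∀ j → (κ ≤ᵇ toℕ j) ∧ (lookup a j ≤ᵇ suc (m + κ)) ≡ true → (κ ≤ᵇ toℕ j) ∧ not (lookup I j) ≡ true
          small⇒outside j small with κ≤j , a≤ ← ∧-true {κ ≤ᵇ toℕ j} small with lookup I j in j∈I
          ... | true  = ⊥-elim (contra j∈I (deg (true-≤ᵇ κ≤j) j∈I) (true-≤ᵇ a≤))
          ... | false = ∧-intro κ≤j refl

        -- Once vertex 0 and all later vertices are outside, a middle vertex has as many arcs
        -- leaving `I` as there are other vertices, and no entry in range exceeds this number plus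
        -- one.
        empty : ∀ i → lookup I i ≡ false
        empty = descend _ step
          where
          step : ∀ i → (∀ j → toℕ i < toℕ j → lookup I j ≡ false) → lookup I i ≡ false
          step i ih with lookup I i in i∈I
          ... | false = refl
          ... | true with trisect κ i
          ...   | inj₁ refl = ⊥-elim (true≢false i∈I 0∉I)
          ...   | inj₂ (inj₂ κ≤i) = ⊥-elim (last∉I i κ≤i i∈I)
          ...   | inj₂ (inj₁ (0<i , i<κ)) = ⊥-elim (contra i∈I n≤deg (proj₂ (range i)))
            where
            n≤deg : n ≤ outDeg G I i
            n≤deg = ≤-reflexive (suc-injective (begin
              suc n                                                ≡⟨ #-≥ (suc (toℕ i)) (toℕ<n i) ⟨
              # {suc n} (λ j → toℕ i <ᵇ toℕ j) + suc (toℕ i)       ≡⟨ +-suc _ (toℕ i) ⟩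
              suc (# {suc n} (λ j → toℕ i <ᵇ toℕ j) + toℕ i)       ≡⟨ cong suc (cong₂ _+_ (#-cong none-inside)
                                                                       (sym (trans (cong (λ b → toℕ i * 𝟙 (not b)) 0∉I) (*-identityʳ _)))) ⟩
              suc (outsideFrom (suc (toℕ i)) I + toℕ i * 𝟙 (not (lookup I zero)))  ≡⟨ cong suc (outDeg-middle κ I i 0<i i<κ) ⟨
              suc (outDeg G I i)                                   ∎))
              where
              open ≡-Reasoning
              none-inside : ∀ j → (toℕ i <ᵇ toℕ j) ≡ (toℕ i <ᵇ toℕ j) ∧ not (lookup I j)
              none-inside j with toℕ i <ᵇ toℕ j in i<j
              ... | false = refl
              ... | true rewrite ih j (true-≤ᵇ i<j) = refl

    burnt⇒gparking : IsGParking G a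
    burnt⇒gparking = proj₁ ∘ range , witness
      where
      witness : ∀ I → Nonempty I → ∃ λ i → (i ∈ₛ I) × (lookup a i < outDeg G I i + 2)
      witness I (i₀ , i₀∈I) with find-true (λ i → lookup I i ∧ (lookup a i <ᵇ outDeg G I i + 2))
      ... | inj₁ (i , p) with i∈I , a< ← ∧-true {lookup I i} p = i , lookup⇒[]= i I i∈I , true-≤ᵇ a<
      ... | inj₂ none = ⊥-elim absurd
        where
        stuck : ∀ i → lookup I i ≡ true → outDeg G I i + 2 ≤ lookup a i
        stuck i i∈I with none i
        ... | q rewrite i∈I = ≤-pred (false-≤ᵇ {suc (lookup a i)} {outDeg G I i + 2} q)
        absurd : ⊥
        absurd with lookup I zero in eq
        ... | true  = First∈I.absurd I stuck eq
        ... | false = true≢false ([]=⇒lookup i₀∈I) (First∉I.empty I stuck eq i₀)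

-- Parking on a line

spot : ℕ → (ℕ → Bool) → ℕ → ℕ
spot zero    o p = p
spot (suc f) o p = if o p then spot f o (suc p) else p

occupy : ℕ → (ℕ → Bool) → ℕ → Bool
occupy s o q = (q ≡ᵇ s) ∨ o q

-- The tail parks before the head because cars enter in descending order of their labels.
occupied : ∀ {m} → ℕ → Vec ℕ m → ℕ → Bool
occupied n []      = λ _ → false
occupied n (x ∷ v) = occupy (spot n (occupied n v) x) (occupied n v)

allParked : ∀ {m} → ℕ → Vec ℕ m → Bool
allParked n []      = true
allParked n (x ∷ v) = (spot n (occupied n v) x ≤ᵇ n) ∧ allParked n v

spot-≥ : ∀ f o p → p ≤ spot f o p
spot-≥ zero    o p = ≤-refl
spot-≥ (suc f) o p with o p
... | true  = ≤-trans (n≤1+n p) (spot-≥ f o (suc p))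
... | false = ≤-refl

spot-skips : ∀ f o p q → p ≤ q → q < spot f o p → o q ≡ true
spot-skips zero    o p q p≤q q<p = ⊥-elim (<⇒≱ q<p p≤q)
spot-skips (suc f) o p q p≤q q<s with o p in op
... | false = ⊥-elim (<⇒≱ q<s p≤q)
... | true with m≤n⇒m<n∨m≡n p≤q
...   | inj₁ p<q  = spot-skips f o (suc p) q p<q q<s
...   | inj₂ refl = op

spot-free : ∀ f o p → o (spot f o p) ≡ false ⊎ spot f o p ≡ p + f
spot-free zero    o p = inj₂ (sym (+-identityʳ p))
spot-free (suc f) o p with o p in op
... | false = inj₁ op
... | true with spot-free f o (suc p)
...   | inj₁ free = inj₁ free
...   | inj₂ eq   = inj₂ (trans eq (sym (+-suc p f)))

occupy-self : ∀ s o → occupy s o s ≡ true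
occupy-self s o rewrite ≡ᵇ-refl s = refl

occupy-other : ∀ {s q} o → q ≢ s → occupy s o q ≡ o q
occupy-other o q≢s rewrite ≡ᵇ-false q≢s = refl

occupy-false : ∀ s o q → occupy s o q ≡ false → q ≢ s × o q ≡ false
occupy-false s o q eq with q ≡ᵇ s in q≡s
... | false = (λ { refl → true≢false (≡ᵇ-refl q) q≡s }) , eq

#occ : (ℕ → Bool) → ℕ → ℕ
#occ o zero    = 0
#occ o (suc q) = 𝟙 (o (suc q)) + #occ o q

#occ-empty : ∀ q → #occ (λ _ → false) q ≡ 0
#occ-empty zero    = refl
#occ-empty (suc q) = #occ-empty q

#occ-occupy : ∀ s o → 1 ≤ s → o s ≡ false → ∀ q → #occ (occupy s o) q ≡ 𝟙 (s ≤ᵇ q) + #occ o q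
#occ-occupy (suc s) o 1≤s free zero = refl
#occ-occupy s o 1≤s free (suc q) with suc q ≟ s
... | yes refl rewrite occupy-self s o | free | ≤ᵇ-true (≤-refl {s})
                     | #occ-occupy s o 1≤s free q | ≤ᵇ-false {s} {q} ≤-refl = refl
... | no q≢s rewrite occupy-other o q≢s | #occ-occupy s o 1≤s free q = begin
  𝟙 (o (suc q)) + (𝟙 (s ≤ᵇ q) + #occ o q)     ≡⟨ cong (λ b → 𝟙 (o (suc q)) + (𝟙 b + #occ o q)) same ⟩
  𝟙 (o (suc q)) + (𝟙 (s ≤ᵇ suc q) + #occ o q) ≡⟨ x∙yz≈y∙xz (𝟙 (o (suc q))) (𝟙 (s ≤ᵇ suc q)) (#occ o q) ⟩
  𝟙 (s ≤ᵇ suc q) + (𝟙 (o (suc q)) + #occ o q) ∎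
  where
  open ≡-Reasoning
  same : (s ≤ᵇ q) ≡ (s ≤ᵇ suc q)
  same with s ≤? q
  ... | yes s≤q = trans (≤ᵇ-true s≤q) (sym (≤ᵇ-true (m≤n⇒m≤1+n s≤q)))
  ... | no  s≰q = trans (≤ᵇ-false (≰⇒> s≰q)) (sym (≤ᵇ-false (≤∧≢⇒< (≰⇒> s≰q) q≢s)))

#occ-upper : ∀ o e d → #occ o (e + d) ≤ #occ o e + d
#occ-upper o e zero    = ≤-reflexive (trans (cong (#occ o) (+-identityʳ e)) (sym (+-identityʳ _)))
#occ-upper o e (suc d) rewrite +-suc e d | +-suc (#occ o e) d =
  +-mono-≤ (𝟙≤1 (o (suc (e + d)))) (#occ-upper o e d)

#occ-full : ∀ o e d → (∀ q → e < q → q ≤ e + d → o q ≡ true) → #occ o (e + d) ≡ #occ o e + d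
#occ-full o e zero    full = trans (cong (#occ o) (+-identityʳ e)) (sym (+-identityʳ _))
#occ-full o e (suc d) full rewrite +-suc e d | +-suc (#occ o e) d | full (suc (e + d)) (s≤s (m≤m+n e d)) ≤-refl =
  cong suc (#occ-full o e d λ q e<q q≤ → full q e<q (m≤n⇒m≤1+n q≤))

count≤ : ∀ {m} → Vec ℕ m → ℕ → ℕ
count≤ []      q = 0
count≤ (x ∷ v) q = 𝟙 (x ≤ᵇ q) + count≤ v q

count≤-upper : ∀ {m} (v : Vec ℕ m) q → count≤ v q ≤ m
count≤-upper []      q = z≤n
count≤-upper (x ∷ v) q = +-mono-≤ (𝟙≤1 (x ≤ᵇ q)) (count≤-upper v q)

Positive : ∀ {m} → Vec ℕ m → Set
Positive v = ∀ i → 1 ≤ lookup v i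

run : (ℕ → Bool) → ℕ → Bool
run o zero    = true
run o (suc j) = o (suc j) ∧ run o j

-- The length of the initial block of occupied spots, written as a sum over its possible ends so
-- that it matches `firstGap` on the circle term by term.
leadingRun : (ℕ → Bool) → ℕ → ℕ
leadingRun o zero    = 0
leadingRun o (suc j) = 𝟙 (run o (suc j)) + leadingRun o j

leadingRun-full : ∀ o u → run o u ≡ true → leadingRun o u ≡ u
leadingRun-full o zero    _ = refl
leadingRun-full o (suc u) full rewrite full = cong suc (leadingRun-full o u (proj₂ (∧-true {o (suc u)} full)))

leadingRun-spec : ∀ o u → run o u ≡ false →
                  run o (leadingRun o u) ≡ true × run o (suc (leadingRun o u)) ≡ false
leadingRun-spec o (suc u) notfull rewrite notfull with run o u in eq
... | false = leadingRun-spec o u eq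
... | true rewrite leadingRun-full o u eq = eq , trans (cong (o (suc u) ∧_) eq) notfull

run-#occ : ∀ o j → run o j ≡ true → #occ o j ≡ j
run-#occ o zero    _ = refl
run-#occ o (suc j) r with oj , r′ ← ∧-true {o (suc j)} r rewrite oj = cong suc (run-#occ o j r′)

run-≤ : ∀ o {i j} → i ≤ j → run o j ≡ true → run o i ≡ true
run-≤ o {i} {j} i≤j r with m≤n⇒m<n∨m≡n i≤j
... | inj₂ refl = r
run-≤ o {i} {suc j} _ r | inj₁ (s≤s i≤j) = run-≤ o i≤j (proj₂ (∧-true {o (suc j)} r))

module _ (n : ℕ) where

  private
    occ : ∀ {m} → Vec ℕ m → ℕ → Bool
    occ = occupied n

  -- Cars only move forward, so a spot up to q holds a car that prefers a spot up to q. The proof is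
  -- mutual with `spot-is-free`: counting needs each new spot to have been empty, and if the search
  -- ran out of fuel it would have met n occupied spots, more than there are cars.
  #occ≤count : ∀ {m} (v : Vec ℕ m) → m ≤ n → Positive v → ∀ q → #occ (occ v) q ≤ count≤ v q
  spot-is-free : ∀ {m} (x : ℕ) (v : Vec ℕ m) → m < n → 1 ≤ x → Positive v →
                 occ v (spot n (occ v) x) ≡ false

  #occ≤count []      _ _ q = ≤-reflexive (#occ-empty q)
  #occ≤count (x ∷ v) m<n pos q = ≤-trans
    (≤-reflexive (#occ-occupy s (occ v) (≤-trans (pos zero) x≤s) (spot-is-free x v m<n (pos zero) (pos ∘ suc)) q))
    (+-mono-≤ (𝟙-mono {s ≤ᵇ q} λ s≤q → ≤ᵇ-true (≤-trans x≤s (true-≤ᵇ s≤q)))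
              (#occ≤count v (<⇒≤ m<n) (pos ∘ suc) q))
    where
    s = spot n (occ v) x
    x≤s = spot-≥ n (occ v) x

  spot-is-free {m} (suc x) v m<n _ pos with spot-free n (occ v) (suc x)
  ... | inj₁ free = free
  ... | inj₂ s≡x+n = ⊥-elim (<⇒≱ m<n (begin
    n                               ≤⟨ m≤n+m n _ ⟩
    #occ (occ v) x + n              ≡⟨ #occ-full (occ v) x n full ⟨
    #occ (occ v) (x + n)            ≤⟨ #occ≤count v (<⇒≤ m<n) pos (x + n) ⟩
    count≤ v (x + n)                ≤⟨ count≤-upper v (x + n) ⟩
    m                               ∎))
    where
    open ≤-Reasoning
    full : ∀ q → x < q → q ≤ x + n → occ v q ≡ true
    full q x<q q≤ = spot-skips n (occ v) (suc x) q x<q (≤-trans (s≤s q≤) (≤-reflexive (sym s≡x+n)))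

  -- No car drives past an empty spot. If q is empty at the end, it was empty throughout, so every
  -- car preferring a spot up to q stopped before q.
  count≤#occ : ∀ {m} (v : Vec ℕ m) → m ≤ n → Positive v → ∀ q → occ v q ≡ false → count≤ v q ≤ #occ (occ v) q
  count≤#occ []      _ _ q _ = z≤n
  count≤#occ (x ∷ v) m<n pos q q-free with q≢s , q-free′ ← occupy-false (spot n (occ v) x) (occ v) q q-free = ≤-trans
    (+-mono-≤ (𝟙-mono {x ≤ᵇ q} λ x≤q → ≤ᵇ-true (≮⇒≥ λ q<s →
                 true≢false (spot-skips n (occ v) x q (true-≤ᵇ x≤q) q<s) q-free′))
              (count≤#occ v (<⇒≤ m<n) (pos ∘ suc) q q-free′))
    (≤-reflexive (sym (#occ-occupy s (occ v) (≤-trans (pos zero) (spot-≥ n (occ v) x))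
                        (spot-is-free x v m<n (pos zero) (pos ∘ suc)) q)))
    where s = spot n (occ v) x

  allParked⇒#occ : ∀ {m} (v : Vec ℕ m) → m ≤ n → Positive v → allParked n v ≡ true → #occ (occ v) n ≡ m
  allParked⇒#occ []      _ _ _ = #occ-empty n
  allParked⇒#occ (x ∷ v) m<n pos parked with s≤n , parked′ ← ∧-true {spot n (occ v) x ≤ᵇ n} parked = trans
    (#occ-occupy (spot n (occ v) x) (occ v) (≤-trans (pos zero) (spot-≥ n (occ v) x))
      (spot-is-free x v m<n (pos zero) (pos ∘ suc)) n)
    (cong₂ _+_ (cong 𝟙 s≤n) (allParked⇒#occ v (<⇒≤ m<n) (pos ∘ suc) parked′))

  -- All m cars stand in 1, ..., n. At most n - q of them stand beyond q, and each of the others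
  -- prefers a spot up to q.
  allParked⇒bound : ∀ {m} (v : Vec ℕ m) → m ≤ n → Positive v → allParked n v ≡ true →
                    ∀ q → q ≤ n → m + q ≤ count≤ v q + n
  allParked⇒bound {m} v m≤n pos parked q q≤n with d , refl ← m≤n⇒∃[o]m+o≡n q≤n = begin
    m + q                           ≡⟨ cong (_+ q) (allParked⇒#occ v m≤n pos parked) ⟨
    #occ (occ v) (q + d) + q        ≤⟨ +-monoˡ-≤ q (#occ-upper (occ v) q d) ⟩
    #occ (occ v) q + d + q          ≤⟨ +-monoˡ-≤ q (+-monoˡ-≤ d (#occ≤count v m≤n pos q)) ⟩
    count≤ v q + d + q              ≡⟨ +-assoc (count≤ v q) d q ⟩
    count≤ v q + (d + q)            ≡⟨ cong (count≤ v q +_) (+-comm d q) ⟩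
    count≤ v q + (q + d)            ∎
    where open ≤-Reasoning

  occ-zero : ∀ {m} (v : Vec ℕ m) → Positive v → occ v 0 ≡ false
  occ-zero []      pos = refl
  occ-zero (x ∷ v) pos = trans
    (occupy-other (occ v) (λ 0≡s → <⇒≢ (≤-trans (pos zero) (spot-≥ n (occ v) x)) 0≡s))
    (occ-zero v (pos ∘ suc))

  last-free : ∀ (o : ℕ → Bool) → o 0 ≡ false → ∀ x → ∃ λ e → e ≤ x × o e ≡ false × (∀ q → e < q → q ≤ x → o q ≡ true)
  last-free o o0 zero    = 0 , z≤n , o0 , λ q 0<q q≤0 → ⊥-elim (<⇒≱ 0<q q≤0)
  last-free o o0 (suc x) with o (suc x) in eq
  ... | false = suc x , ≤-refl , eq , λ q x<q q≤x → ⊥-elim (<⇒≱ x<q q≤x)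
  ... | true with e , e≤x , oe , full ← last-free o o0 x =
    e , m≤n⇒m≤1+n e≤x , oe , λ q e<q q≤x → case q e<q (m≤n⇒m<n∨m≡n q≤x)
    where
    case : ∀ q → e < q → q < suc x ⊎ q ≡ suc x → o q ≡ true
    case q e<q (inj₁ (s≤s q≤x)) = full q e<q q≤x
    case q e<q (inj₂ refl)      = eq

  -- Suppose that the head overflows, and let e be the last free spot before its preference, where
  -- spot 0 counts as free. Then e + 1, ..., n are all occupied, so only m - (n - e) of the m
  -- earlier cars stand in 1, ..., e. As e is free, no more than these prefer a spot up to e, which
  -- violates the bound at q = e.
  bound⇒allParked : ∀ {m} (v : Vec ℕ m) → m ≤ n → Positive v → (∀ i → lookup v i ≤ n) →
                    (∀ q → q ≤ n → m + q ≤ count≤ v q + n) → allParked n v ≡ true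
  bound⇒allParked []         _ _ _ _ = refl
  bound⇒allParked (zero ∷ v) _ pos _ _ = ⊥-elim (n≮0 (pos zero))
  bound⇒allParked {suc m} (suc x ∷ v) m<n pos upper bound = ∧-intro (≤ᵇ-true (≮⇒≥ overflow)) parked
    where
    s = spot n (occ v) (suc x)
    parked : allParked n v ≡ true
    parked = bound⇒allParked v (<⇒≤ m<n) (pos ∘ suc) (upper ∘ suc) λ q q≤n →
      ≤-pred (≤-trans (bound q q≤n) (+-monoˡ-≤ n (+-monoˡ-≤ (count≤ v q) (𝟙≤1 (suc x ≤ᵇ q)))))
    overflow : ¬ (n < s)
    overflow n<s with last-free (occ v) (occ-zero v (pos ∘ suc)) x
    ... | e , e≤x , e-free , full with m≤n⇒∃[o]m+o≡n (≤-trans e≤x (<⇒≤ (upper zero)))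
    ... | d , e+d≡n = <⇒≱ (bound e (≤-trans (m≤m+n e d) (≤-reflexive e+d≡n))) (begin
      𝟙 (suc x ≤ᵇ e) + count≤ v e + n    ≡⟨ cong (λ b → 𝟙 b + count≤ v e + n) (≤ᵇ-false {suc x} (s≤s e≤x)) ⟩
      count≤ v e + n                     ≤⟨ +-monoˡ-≤ n (count≤#occ v (<⇒≤ m<n) (pos ∘ suc) e e-free) ⟩
      #occ (occ v) e + n                 ≡⟨ cong (#occ (occ v) e +_) (trans (sym e+d≡n) (+-comm e d)) ⟩
      #occ (occ v) e + (d + e)           ≡⟨ +-assoc (#occ (occ v) e) d e ⟨
      #occ (occ v) e + d + e             ≡⟨ cong (_+ e) (#occ-full (occ v) e d full′) ⟨
      #occ (occ v) (e + d) + e           ≡⟨ cong (λ z → #occ (occ v) z + e) e+d≡n ⟩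
      #occ (occ v) n + e                 ≡⟨ cong (_+ e) (allParked⇒#occ v (<⇒≤ m<n) (pos ∘ suc) parked) ⟩
      m + e                              ∎)
      where
      open ≤-Reasoning
      full′ : ∀ q → e < q → q ≤ e + d → occ v q ≡ true
      full′ q e<q q≤ with q ≤? x
      ... | yes q≤x = full q e<q q≤x
      ... | no  q≰x = spot-skips n (occ v) (suc x) q (≰⇒> q≰x)
                        (≤-trans (s≤s (≤-trans q≤ (≤-reflexive e+d≡n))) n<s)

  -- The two comparisons of cars with occupied spots are applied to the full spots 1, ..., r and to
  -- the empty spot r + 1, which exists because there are fewer cars than spots.
  leadingRun-isRun : ∀ {m} (v : Vec ℕ m) → m < n → Positive v → IsRun (count≤ v) (leadingRun (occ v) n)
  leadingRun-isRun {m} v m<n pos with run (occ v) n in eq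
  ... | true = ⊥-elim (<⇒≱ m<n (begin
    n               ≡⟨ run-#occ (occ v) n eq ⟨
    #occ (occ v) n  ≤⟨ #occ≤count v (<⇒≤ m<n) pos n ⟩
    count≤ v n      ≤⟨ count≤-upper v n ⟩
    m               ∎))
    where open ≤-Reasoning
  ... | false with full , notfull ← leadingRun-spec (occ v) n eq =
    (λ q q≤r → ≤-trans (≤-reflexive (sym (run-#occ (occ v) q (run-≤ (occ v) q≤r full)))) (#occ≤count v (<⇒≤ m<n) pos q)) ,
    (begin
      count≤ v (suc r)                      ≤⟨ count≤#occ v (<⇒≤ m<n) pos (suc r) free ⟩
      𝟙 (occ v (suc r)) + #occ (occ v) r    ≡⟨ cong₂ (λ b z → 𝟙 b + z) free (run-#occ (occ v) r full) ⟩
      r                                     ∎)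
    where
    open ≤-Reasoning
    r = leadingRun (occ v) n
    free : occ v (suc r) ≡ false
    free with occ v (suc r)
    ... | false = refl
    ... | true  = ⊥-elim (true≢false full notfull)

  parkedAt : ∀ {m} → Vec ℕ m → Fin m → ℕ
  parkedAt (x ∷ v) zero    = spot n (occ v) x
  parkedAt (x ∷ v) (suc i) = parkedAt v i

-- The parking algorithm as a recursion on the vector

findFree-spot : ∀ f spp o → (∀ q → (spp q ≡ᵇ 0) ≡ not (o q)) → ∀ p → findFree f spp p ≡ spot f o p
findFree-spot zero    spp o eq p = refl
findFree-spot (suc f) spp o eq p rewrite eq p with o p
... | true  = findFree-spot f spp o eq (suc p)
... | false = refl

module _ {n : ℕ} (a : Vec ℕ n) where

  private
    start : (ℕ → ℕ) × (Fin n → ℕ)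
    start = (λ _ → 0) , (λ _ → 0)
    state : List (Fin n) → (ℕ → ℕ) × (Fin n → ℕ)
    state = foldr (flip (parkStep a)) start

  -- The embedding `e` places the suffix `v` inside `a`, so that the induction can run over
  -- suffixes. Its injectivity ensures that a new car does not overwrite the recorded position of an
  -- earlier one.
  parkStep-state : ∀ {m} (v : Vec ℕ m) (e : Fin m → Fin n) → (∀ {i j} → e i ≡ e j → i ≡ j) →
    (∀ i → lookup a (e i) ≡ lookup v i) →
    let spp , pp = state (Vec.toList (tabulate e)) in
    (∀ q → (spp q ≡ᵇ 0) ≡ not (occupied n v q)) × (∀ i → pp (e i) ≡ parkedAt n v i)
  parkStep-state []      e inj a∘e = (λ _ → refl) , λ ()
  parkStep-state (x ∷ v) e inj a∘e
    with ih₁ , ih₂ ← parkStep-state v (e ∘ suc) (λ eq → Fin.suc-injective (inj eq)) (a∘e ∘ suc) =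
    spp-eq , pp-eq
    where
    st = state (Vec.toList (tabulate (e ∘ suc)))
    same-spot : findFree n (proj₁ st) (lookup a (e zero)) ≡ spot n (occupied n v) x
    same-spot = trans (cong (findFree n (proj₁ st)) (a∘e zero)) (findFree-spot n _ _ ih₁ x)
    spp-eq : ∀ q → ((if q ≡ᵇ findFree n (proj₁ st) (lookup a (e zero)) then label (e zero) else proj₁ st q) ≡ᵇ 0)
                   ≡ not (occupied n (x ∷ v) q)
    spp-eq q rewrite same-spot with q ≡ᵇ spot n (occupied n v) x
    ... | true  = refl
    ... | false = ih₁ q
    pp-eq : ∀ i → (if toℕ (e i) ≡ᵇ toℕ (e zero) then findFree n (proj₁ st) (lookup a (e zero)) else proj₂ st (e i))
                  ≡ parkedAt n (x ∷ v) i
    pp-eq zero rewrite ≡ᵇ-refl (toℕ (e zero)) = same-spot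
    pp-eq (suc i) rewrite ≡ᵇ-false {toℕ (e (suc i))} {toℕ (e zero)} (λ eq → Fin.0≢1+n (sym (inj (toℕ-injective eq)))) = ih₂ i

  parkingPos-parkedAt : ∀ i → parkingPos a i ≡ parkedAt n a i
  parkingPos-parkedAt i = trans
    (cong (λ st → proj₂ st i) (reverse-foldl (parkStep a) start (finList n)))
    (proj₂ (parkStep-state a id id (λ _ → refl)) i)

module _ (n : ℕ) where

  allParked⇒positions : ∀ {m} (v : Vec ℕ m) → allParked n v ≡ true → ∀ i → parkedAt n v i ≤ n
  allParked⇒positions (x ∷ v) parked zero    = true-≤ᵇ (proj₁ (∧-true parked))
  allParked⇒positions (x ∷ v) parked (suc i) =
    allParked⇒positions v (proj₂ (∧-true {spot n (occupied n v) x ≤ᵇ n} parked)) i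

  positions⇒allParked : ∀ {m} (v : Vec ℕ m) → (∀ i → parkedAt n v i ≤ n) → allParked n v ≡ true
  positions⇒allParked []      _   = refl
  positions⇒allParked (x ∷ v) pos = ∧-intro (≤ᵇ-true (pos zero)) (positions⇒allParked v (pos ∘ suc))

  -- The first κ cars enter after all the others and so cannot influence them.
  allParked⇒last : ∀ κ {N} (v : Vec ℕ (κ + N)) → allParked n (Vec.drop κ v) ≡ true →
                   ∀ i → κ ≤ toℕ i → parkedAt n v i ≤ n
  allParked⇒last zero    v       parked i       _         = allParked⇒positions v parked i
  allParked⇒last (suc κ) (x ∷ v) parked (suc i) (s≤s κ≤i) = allParked⇒last κ v parked i κ≤i

  last⇒allParked : ∀ κ {N} (v : Vec ℕ (κ + N)) → (∀ i → κ ≤ toℕ i → parkedAt n v i ≤ n) →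
                   allParked n (Vec.drop κ v) ≡ true
  last⇒allParked zero    v       pos = positions⇒allParked v λ i → pos i z≤n
  last⇒allParked (suc κ) (x ∷ v) pos = last⇒allParked κ v λ i κ≤i → pos (suc i) (s≤s κ≤i)

countFrom-zero : ∀ {m} (v : Vec ℕ m) q → countFrom 0 v q ≡ count≤ v q
countFrom-zero []      q = #-sum _
countFrom-zero (x ∷ v) q = trans (#-suc _) (cong (𝟙 (x ≤ᵇ q) +_) (countFrom-zero v q))

countFrom-drop : ∀ κ {N} (v : Vec ℕ (κ + N)) q → countFrom κ v q ≡ count≤ (drop κ v) q
countFrom-drop zero    v       q = countFrom-zero v q
countFrom-drop (suc κ) (x ∷ v) q = trans (#-suc _)
  (trans (#-cong λ i → cong (_∧ (lookup v i ≤ᵇ q)) (suc-≤ᵇ-suc κ (toℕ i))) (countFrom-drop κ v q))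

count≤-mono : ∀ {m} (v : Vec ℕ m) {p q} → p ≤ q → count≤ v p ≤ count≤ v q
count≤-mono []      p≤q = z≤n
count≤-mono (x ∷ v) {p} {q} p≤q =
  +-mono-≤ (𝟙-mono {x ≤ᵇ p} λ x≤p → ≤ᵇ-true (≤-trans (true-≤ᵇ {x} x≤p) p≤q)) (count≤-mono v p≤q)

count≤-all : ∀ {m} (v : Vec ℕ m) {q} → (∀ i → lookup v i ≤ q) → count≤ v q ≡ m
count≤-all []      upper = refl
count≤-all (x ∷ v) upper = cong₂ _+_ (cong 𝟙 (≤ᵇ-true (upper zero))) (count≤-all v (upper ∘ suc))

IsRun-unique : ∀ {c c′ r r′} → (∀ q → c q ≡ c′ q) → IsRun c r → IsRun c′ r′ → r ≡ r′
IsRun-unique {r = r} {r′} c≗c′ (low , high) (low′ , high′) with <-cmp r r′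
... | tri≈ _ r≡r′ _ = r≡r′
... | tri< r<r′ _ _ = ⊥-elim (<⇒≱ (≤-trans (low′ (suc r) r<r′) (≤-reflexive (sym (c≗c′ _)))) high)
... | tri> _ _ r′<r = ⊥-elim (<⇒≱ (≤-trans (low (suc r′) r′<r) (≤-reflexive (c≗c′ _))) high′)

-- The centre

-- One decision in a pass from the largest index down. The greedy centre and the burning of the
-- middle vertices both consist of such steps, which is why they agree once they start from the same
-- number.
burnStep : ℕ → ℕ → ℕ
burnStep x r = 𝟙 (x ≤ᵇ suc r) + r

centreSize : ∀ {m} → Vec ℕ m → ℕ
centreSize []      = 0
centreSize (x ∷ v) = burnStep x (centreSize v)

centre : ∀ {m} → Vec ℕ m → Subset m
centre []      = []
centre (x ∷ v) = (x ≤ᵇ suc (centreSize v)) ∷ centre v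

#-centre : ∀ {m} (v : Vec ℕ m) → # (lookup (centre v)) ≡ centreSize v
#-centre []      = #-sum _
#-centre (x ∷ v) = trans (#-suc _) (cong (𝟙 (x ≤ᵇ suc (centreSize v)) +_) (#-centre v))

rankIn-# : ∀ {m} (S : Subset m) s → rankIn S s ≡ # (λ t → lookup S t ∧ (toℕ s ≤ᵇ toℕ t))
rankIn-# {m} S s = trans (length-filterᵇ (λ t → lookup S t ∧ (toℕ s ≤ᵇ toℕ t)) (finList m)) (trans (lsum-finList {m} _) (sym (#-sum _)))

rankIn-zero : ∀ {m} s (S : Subset m) → rankIn (s ∷ S) zero ≡ 𝟙 s + # (lookup S)
rankIn-zero s S = trans (rankIn-# (s ∷ S) zero) (trans (#-suc _)
  (cong₂ _+_ (cong 𝟙 (∧-identityʳ s)) (#-cong λ t → ∧-identityʳ (lookup S t))))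

rankIn-suc : ∀ {m} s (S : Subset m) i → rankIn (s ∷ S) (suc i) ≡ rankIn S i
rankIn-suc s S i = trans (rankIn-# (s ∷ S) (suc i)) (trans (#-suc _) (trans
  (cong₂ _+_ (cong 𝟙 (∧-zeroʳ s)) (#-cong λ t → cong (lookup S t ∧_) (suc-≤ᵇ-suc (toℕ i) (toℕ t))))
  (sym (rankIn-# S i))))

centre-candidate : ∀ {m} (b : Vec ℕ m) s → lookup (centre b) s ≡ true → lookup b s ≤ rankIn (centre b) s
centre-candidate (x ∷ v) zero    s∈ = ≤-trans (true-≤ᵇ s∈) (≤-reflexive (sym
  (trans (rankIn-zero _ (centre v)) (cong₂ _+_ (cong 𝟙 s∈) (#-centre v)))))
centre-candidate (x ∷ v) (suc s) s∈ = ≤-trans (centre-candidate v s s∈)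
  (≤-reflexive (sym (rankIn-suc (x ≤ᵇ suc (centreSize v)) (centre v) s)))

-- The rank of an index counts only indices from it upwards. By induction the larger members of any
-- candidate set lie in the greedy set, so the greedy pass accepts whatever a candidate set
-- contains.
centre-largest : ∀ {m} (b : Vec ℕ m) (S : Subset m) → (∀ s → lookup S s ≡ true → lookup b s ≤ rankIn S s) →
                 ∀ s → lookup S s ≡ true → lookup (centre b) s ≡ true
centre-largest (x ∷ v) (s₀ ∷ S) cand = go
  where
  tail : ∀ s → lookup S s ≡ true → lookup (centre v) s ≡ true
  tail = centre-largest v S λ s s∈ → ≤-trans (cand (suc s) s∈) (≤-reflexive (rankIn-suc s₀ S s))
  go : ∀ s → lookup (s₀ ∷ S) s ≡ true → lookup (centre (x ∷ v)) s ≡ true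
  go (suc s) s∈ = tail s s∈
  go zero    s∈ = ≤ᵇ-true (begin
    x                        ≤⟨ cand zero s∈ ⟩
    rankIn (s₀ ∷ S) zero     ≡⟨ rankIn-zero s₀ S ⟩
    𝟙 s₀ + # (lookup S)      ≤⟨ +-mono-≤ (𝟙≤1 s₀) (#-mono tail) ⟩
    suc (# (lookup (centre v))) ≡⟨ cong suc (#-centre v) ⟩
    suc (centreSize v)       ∎)
    where open ≤-Reasoning

centre-isCentre : ∀ {m} (b : Vec ℕ m) → IsCentre b (centre b)
centre-isCentre b = (λ s s∈ → centre-candidate b s ([]=⇒lookup s∈)) ,
  λ S cand {s} s∈ → lookup⇒[]= s (centre b)
    (centre-largest b S (λ s s∈ → cand s (lookup⇒[]= s S s∈)) s ([]=⇒lookup s∈))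

Descending : ∀ {m} → Vec ℕ m → Set
Descending v = ∀ i j → toℕ j ≡ suc (toℕ i) → lookup v j ≤ lookup v i

Descending-tail : ∀ {m x} {v : Vec ℕ m} → Descending (x ∷ v) → Descending v
Descending-tail desc i j j≡1+i = desc (suc i) (suc j) (cong suc j≡1+i)

Descending-head : ∀ {m x} (v : Vec ℕ m) → Descending (x ∷ v) → ∀ i → lookup v i ≤ x
Descending-head (y ∷ v) desc zero    = desc zero (suc zero) refl
Descending-head (y ∷ v) desc (suc i) =
  ≤-trans (Descending-head v (Descending-tail {v = y ∷ v} desc) i) (desc zero (suc zero) refl)

-- The head is a largest entry. If it is refused, it exceeds r + 1 and leaves the counts up to r + 1
-- unchanged. If it is accepted, all entries are at most r + 1, so the tail has at most r of them,
-- and the count with the head can never exceed r + 1.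
centreSize-isRun : ∀ {m} (v : Vec ℕ m) → Descending v → IsRun (count≤ v) (centreSize v)
centreSize-isRun []      desc = (λ { zero _ → z≤n }) , z≤n
centreSize-isRun {suc m} (x ∷ v) desc with low , high ← centreSize-isRun v (Descending-tail desc) with x ≤? suc (centreSize v)
... | no x≰ = subst (IsRun (count≤ (x ∷ v))) (sym (cong (λ b → 𝟙 b + r) (≤ᵇ-false (≰⇒> x≰))))
  ((λ q q≤r → ≤-trans (low q q≤r) (m≤n+m _ (𝟙 (x ≤ᵇ q)))) ,
   ≤-trans (≤-reflexive (cong (λ b → 𝟙 b + count≤ v (suc r)) (≤ᵇ-false (≰⇒> x≰)))) high)
  where r = centreSize v
... | yes x≤ = subst (IsRun (count≤ (x ∷ v))) (sym (cong (λ b → 𝟙 b + r) (≤ᵇ-true x≤))) (low′ , (begin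
  𝟙 (x ≤ᵇ 2 + r) + count≤ v (2 + r) ≤⟨ +-mono-≤ (𝟙≤1 (x ≤ᵇ 2 + r)) (count≤-upper v (2 + r)) ⟩
  suc m                             ≡⟨ cong suc (count≤-all v (λ i → ≤-trans (Descending-head v desc i) x≤)) ⟨
  suc (count≤ v (suc r))            ≤⟨ s≤s high ⟩
  suc r                             ∎))
  where
  open ≤-Reasoning
  r = centreSize v
  low′ : ∀ q → q ≤ suc r → q ≤ 𝟙 (x ≤ᵇ q) + count≤ v q
  low′ q q≤ with m≤n⇒m<n∨m≡n q≤
  ... | inj₁ (s≤s q≤r) = ≤-trans (low q q≤r) (m≤n+m _ (𝟙 (x ≤ᵇ q)))
  ... | inj₂ refl rewrite ≤ᵇ-true x≤ = s≤s (≤-trans (low r ≤-refl) (count≤-mono v (n≤1+n r)))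

-- The set burnt before vertex 0

burn : ∀ t {N} → ℕ → Vec ℕ (t + N) → ℕ
burn zero    r v       = r
burn (suc t) r (x ∷ v) = burnStep x (burn t r v)

-- The vector starts with the entry of vertex 1, so its first t = κ - 1 entries belong to the middle
-- vertices and the rest to the last ones.
burntSet : ∀ t {N} → ℕ → Vec ℕ (t + N) → Subset (t + N)
burntSet zero    r v       = Vec.map (_≤ᵇ suc r) v
burntSet (suc t) r (x ∷ v) = (x ≤ᵇ suc (burn t r v)) ∷ burntSet t r v

centreSize-burn : ∀ t {N} (v : Vec ℕ (t + N)) → centreSize v ≡ burn t (centreSize (drop t v)) v
centreSize-burn zero    v       = refl
centreSize-burn (suc t) (x ∷ v) = cong (burnStep x) (centreSize-burn t v)

burn-cong : ∀ t {N} r (v w : Vec ℕ (t + N)) → (∀ i → toℕ i < t → lookup v i ≡ lookup w i) → burn t r v ≡ burn t r w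
burn-cong zero    r v       w       eq = refl
burn-cong (suc t) r (x ∷ v) (y ∷ w) eq =
  cong₂ burnStep (eq zero z<s) (burn-cong t r v w λ i i<t → eq (suc i) (s≤s i<t))

module _ (r : ℕ) where

  #-burntSet : ∀ t {N} (v : Vec ℕ (t + N)) → IsRun (count≤ (drop t v)) r → # (lookup (burntSet t r v)) ≡ burn t r v
  -- Exactly r last vertices burn: c(r + 1) ≤ r because the run ends, and c(r + 1) ≥ c(r) ≥ r
  -- because it reaches r.
  #-burntSet zero    v (low , high) = trans (trans (#-cong λ i → lookup-map i (_≤ᵇ suc r) v) (countFrom-zero v (suc r)))
    (≤-antisym high (≤-trans (low r ≤-refl) (count≤-mono v (n≤1+n r))))
  #-burntSet (suc t) (x ∷ v) isRun = trans (#-suc _) (cong (𝟙 (x ≤ᵇ suc (burn t r v)) +_) (#-burntSet t v isRun))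

  burntSet-last : ∀ t {N} (v : Vec ℕ (t + N)) i → t ≤ toℕ i → lookup (burntSet t r v) i ≡ (lookup v i ≤ᵇ suc r)
  burntSet-last zero    v       i       _         = lookup-map i (_≤ᵇ suc r) v
  burntSet-last (suc t) (x ∷ v) (suc i) (s≤s t≤i) = burntSet-last t v i t≤i

  burntSet-middle : ∀ t {N} (v : Vec ℕ (t + N)) → IsRun (count≤ (drop t v)) r → ∀ i → toℕ i < t →
    lookup (burntSet t r v) i ≡ (lookup v i ≤ᵇ suc (# λ j → (toℕ i <ᵇ toℕ j) ∧ lookup (burntSet t r v) j))
  burntSet-middle (suc t) (x ∷ v) isRun zero    _ =
    cong (λ z → x ≤ᵇ suc z) (sym (trans (#-suc _) (#-burntSet t v isRun)))
  burntSet-middle (suc t) (x ∷ v) isRun (suc i) (s≤s i<t) =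
    trans (burntSet-middle t v isRun i i<t) (cong (λ z → lookup v i ≤ᵇ suc z) (sym (#-suc _)))

  burntExceptFirst : ∀ t {N} → Vec ℕ (t + N) → Fin (suc (t + N)) → Bool
  burntExceptFirst t v = lookup (false ∷ burntSet t r v)

  burntExceptFirst-isBurnt : ∀ t {N} x (v : Vec ℕ (t + N)) → IsRun (count≤ (drop t v)) r →
    IsBurnt (suc t) (x ∷ v) r (burntExceptFirst t v)
  burntExceptFirst-isBurnt t x v isRun@(low , high) = record
    { isRun       = (λ q q≤r → ≤-trans (low q q≤r) (≤-reflexive (sym (countFrom-drop (suc t) (x ∷ v) q)))) ,
                    ≤-trans (≤-reflexive (countFrom-drop (suc t) (x ∷ v) (suc r))) high
    ; burn-first  = refl
    ; burn-middle = λ { (suc i) _ (s≤s i<t) → trans (burntSet-middle t v isRun i i<t)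
                          (cong (λ z → lookup v i ≤ᵇ suc z) (sym (#-suc _))) }
    ; burn-last   = λ { (suc i) (s≤s t≤i) → burntSet-last t v i t≤i }
    }

Positive-drop : ∀ t {N} (v : Vec ℕ (t + N)) → Positive v → Positive (drop t v)
Positive-drop zero    v       pos = pos
Positive-drop (suc t) (x ∷ v) pos = Positive-drop t v (pos ∘ suc)

upper-drop : ∀ t {N n} (v : Vec ℕ (t + N)) → (∀ i → lookup v i ≤ n) → ∀ i → lookup (drop t v) i ≤ n
upper-drop zero    v       upper = upper
upper-drop (suc t) (x ∷ v) upper = upper-drop t v (upper ∘ suc)

runLength : ∀ {m} → ℕ → Vec ℕ m → ℕ
runLength n v = leadingRun (occupied n v) n

FirstBurns : ∀ t {N} → Vec ℕ (suc (t + N)) → Set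
FirstBurns t {N} (x ∷ v) = x ≤ suc (burn t (runLength (suc (t + N)) (drop t v)) v)

-- The common form to which G-parking functions, k-partial parking functions and the enumeration are
-- all reduced.
Burns : ∀ t {N} → Vec ℕ (suc (t + N)) → Set
Burns t {N} a = InRange a × allParked (suc (t + N)) (drop (suc t) a) ≡ true × FirstBurns t a

module _ (t N : ℕ) where

  private
    n : ℕ
    n = suc (t + N)
    N<n : N < n
    N<n = s≤s (m≤n+m N t)

    -- As n = κ + N, cancelling `N` turns the inequality that comes from parking into
    -- `ParkingBound`.
    swap-bound : ∀ c q → N + q ≤ c + n → q ≤ c + suc t
    swap-bound c q le = +-cancelˡ-≤ N q (c + suc t) (≤-trans le (≤-reflexive (begin
      c + (suc t + N)   ≡⟨ +-assoc c (suc t) N ⟨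
      c + suc t + N     ≡⟨ +-comm (c + suc t) N ⟩
      N + (c + suc t)   ∎)))
      where open ≡-Reasoning

    swap-bound⁻¹ : ∀ c q → q ≤ c + suc t → N + q ≤ c + n
    swap-bound⁻¹ c q le = ≤-trans (+-monoʳ-≤ N le) (≤-reflexive (begin
      N + (c + suc t)   ≡⟨ +-comm N (c + suc t) ⟩
      c + suc t + N     ≡⟨ +-assoc c (suc t) N ⟩
      c + (suc t + N)   ∎))
      where open ≡-Reasoning

  run-drop : ∀ (a : Vec ℕ n) → Positive a →
             IsRun (count≤ (drop (suc t) a)) (runLength n (drop (suc t) a))
  run-drop a pos = leadingRun-isRun n (drop (suc t) a) N<n (Positive-drop (suc t) a pos)

  gparking⇔burns : 1 ≤ N → ∀ (a : Vec ℕ n) → IsGParking (graphG n (2 + t)) a ⇔ Burns t a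
  gparking⇔burns 1≤N a@(x ∷ v) = mk⇔ to from
    where
    r = runLength n (drop t v)
    t<t+N : suc t ≤ t + N
    t<t+N = ≤-trans (≤-reflexive (+-comm 1 t)) (+-monoʳ-≤ t 1≤N)
    burnt : Positive a → IsBurnt (suc t) a r (burntExceptFirst r t v)
    burnt pos = burntExceptFirst-isBurnt r t x v (run-drop a pos)
    size : Positive a → # (burntExceptFirst r t v) ≡ burn t r v
    size pos = trans (#-suc _) (#-burntSet r t v (run-drop a pos))
    to : IsGParking (graphG n (2 + t)) a → Burns t a
    to park@(pos , _) = range , parked , ≤-trans first (s≤s (≤-reflexive (size pos)))
      where
      range = gparking⇒range z<s t<t+N a (burnt pos) park
      first = gparking⇒first z<s t<t+N a (burnt pos) park
      parked = bound⇒allParked n (drop t v) (<⇒≤ N<n) (Positive-drop (suc t) a pos) (upper-drop (suc t) a (proj₂ ∘ range))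
        λ q q≤n → swap-bound⁻¹ _ q (≤-trans (gparking⇒bound z<s t<t+N a (burnt pos) park q q≤n)
                                            (≤-reflexive (cong (_+ suc t) (countFrom-drop (suc t) a q))))
    from : Burns t a → IsGParking (graphG n (2 + t)) a
    from (range , parked , first) = burnt⇒gparking z<s t<t+N a (burnt pos) range
      (λ q q≤n → ≤-trans (swap-bound _ q (allParked⇒bound n (drop t v) (<⇒≤ N<n) (Positive-drop (suc t) a pos) parked q q≤n))
                         (≤-reflexive (cong (_+ suc t) (sym (countFrom-drop (suc t) a q)))))
      (≤-trans first (s≤s (≤-reflexive (sym (size pos)))))
      where
      pos : Positive a
      pos = proj₁ ∘ range

-- Sorting, and k-partial parking functions

argmax : ∀ {n} (f : Fin (suc n) → ℕ) → ∃ λ m → ∀ i → f i ≤ f m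
argmax {zero}  f = zero , λ { zero → ≤-refl }
argmax {suc n} f with m , max ← argmax (f ∘ suc) with ≤-total (f zero) (f (suc m))
... | inj₁ f0≤fm = suc m , λ { zero → f0≤fm ; (suc i) → max i }
... | inj₂ fm≤f0 = zero  , λ { zero → ≤-refl ; (suc i) → ≤-trans (max i) fm≤f0 }

-- Selection sort: the transposition brings a largest value to the front, and σ arranges the others
-- behind it.
sort : ∀ {n} (f : Fin n → ℕ) →
       ∃ λ (π : Permutation′ n) → ∀ i j → toℕ j ≡ suc (toℕ i) → f (π ⟨$⟩ʳ j) ≤ f (π ⟨$⟩ʳ i)
sort {zero}  f = Perm.id , λ ()
sort {suc n} f with m , max ← argmax f with σ , desc ← sort (f ∘ (transpose zero m ⟨$⟩ʳ_) ∘ suc) =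
  lift₀ σ ∘ₚ transpose zero m ,
  λ { zero (suc j) _ → max _ ; (suc i) (suc j) eq → desc i j (suc-injective eq) }

sortFrom : ∀ κ {N} (f : Fin (κ + N) → ℕ) → ∃ λ (π : Permutation′ (κ + N)) →
  (∀ i → toℕ i < κ → π ⟨$⟩ʳ i ≡ i) ×
  (∀ i j → κ ≤ toℕ i → toℕ j ≡ suc (toℕ i) → f (π ⟨$⟩ʳ j) ≤ f (π ⟨$⟩ʳ i))
sortFrom zero    f with π , desc ← sort f = π , (λ _ ()) , λ i j _ → desc i j
sortFrom (suc κ) f with π , fixed , desc ← sortFrom κ (f ∘ suc) = lift₀ π ,
  (λ { zero _ → refl ; (suc i) (s≤s i<κ) → cong suc (fixed i i<κ) }) ,
  λ { (suc i) (suc j) (s≤s κ≤i) eq → desc i j κ≤i (suc-injective eq) }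

sortingPerm : ∀ κ {N} (a : Vec ℕ (κ + N)) → ∃ (SortingPerm (suc κ) a)
sortingPerm κ a with π , fixed , desc ← sortFrom κ (lookup a) =
  π , (λ i lt → fixed i (≤-pred lt)) , λ i j le → desc i j (≤-pred le)

Descending-drop : ∀ κ {N} (v : Vec ℕ (κ + N)) →
  (∀ i j → κ ≤ toℕ i → toℕ j ≡ suc (toℕ i) → lookup v j ≤ lookup v i) → Descending (drop κ v)
Descending-drop zero    v       desc = λ i j → desc i j z≤n
Descending-drop (suc κ) (x ∷ v) desc = Descending-drop κ v λ i j κ≤i eq → desc (suc i) (suc j) (s≤s κ≤i) (cong suc eq)

-- A permutation that fixes every index below κ maps the remaining ones among themselves, so it only
-- reorders the entries that are counted.
countFrom-permute : ∀ {n} κ (a : Vec ℕ n) (π : Permutation′ n) → (∀ i → toℕ i < κ → π ⟨$⟩ʳ i ≡ i) →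
                    ∀ q → countFrom κ a q ≡ countFrom κ (compose a π) q
countFrom-permute κ a π fixed q = begin
  countFrom κ a q                                  ≡⟨ #-sum _ ⟩
  sum (𝟙 ∘ f)                                      ≡⟨ sum-permute (𝟙 ∘ f) π ⟩
  sum (𝟙 ∘ f ∘ (π ⟨$⟩ʳ_))                          ≡⟨ sum-cong-≗ (cong 𝟙 ∘ same) ⟩
  sum (λ i → 𝟙 ((κ ≤ᵇ toℕ i) ∧ (lookup (compose a π) i ≤ᵇ q))) ≡⟨ #-sum _ ⟨
  countFrom κ (compose a π) q                      ∎
  where
  open ≡-Reasoning
  f = λ i → (κ ≤ᵇ toℕ i) ∧ (lookup a i ≤ᵇ q)
  keeps : ∀ i → (κ ≤ᵇ toℕ (π ⟨$⟩ʳ i)) ≡ (κ ≤ᵇ toℕ i)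
  keeps i with toℕ i <? κ
  ... | yes i<κ rewrite fixed i i<κ = refl
  ... | no  i≮κ with toℕ (π ⟨$⟩ʳ i) <? κ
  ...   | no πi≮κ = trans (≤ᵇ-true (≮⇒≥ πi≮κ)) (sym (≤ᵇ-true (≮⇒≥ i≮κ)))
  ...   | yes πi<κ = ⊥-elim (i≮κ (subst ((_< κ) ∘ toℕ) πi≡i πi<κ))
    where
    πi≡i : π ⟨$⟩ʳ i ≡ i
    πi≡i = trans (sym (Perm.inverseˡ π)) (trans (cong (Perm._⟨$⟩ˡ_ π) (fixed (π ⟨$⟩ʳ i) πi<κ)) (Perm.inverseˡ π))
  same : ∀ i → f (π ⟨$⟩ʳ i) ≡ (κ ≤ᵇ toℕ i) ∧ (lookup (compose a π) i ≤ᵇ q)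
  same i = cong₂ _∧_ (keeps i) (cong (_≤ᵇ q) (sym (lookup∘tabulate (λ i → lookup a (π ⟨$⟩ʳ i)) i)))

module _ (t N : ℕ) where

  private
    n : ℕ
    n = suc (t + N)

  -- Sorting does not change c. Hence the greedy pass over the sorted last entries and the parking
  -- of the unsorted ones arrive at the same r, whichever `π` was chosen. The middle entries stay in
  -- place, and from there on the greedy pass is the burning.
  centre-first : ∀ (a : Vec ℕ n) → Positive a → ∀ π → SortingPerm (2 + t) a π →
                 lookup (centre (compose a π)) zero ≡ true ⇔ FirstBurns t a
  centre-first a@(x ∷ v) pos π (fixed , desc) =
    mk⇔ (λ c → subst id (cong₂ _≤_ b₀≡x (cong suc size)) (true-≤ᵇ c))
        (λ first → ≤ᵇ-true (subst id (sym (cong₂ _≤_ b₀≡x (cong suc size))) first))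
    where
    b = compose a π
    w = Vec.tail b
    lookup-b : ∀ i → lookup b i ≡ lookup a (π ⟨$⟩ʳ i)
    lookup-b = lookup∘tabulate _
    fixed′ : ∀ i → toℕ i < suc t → π ⟨$⟩ʳ i ≡ i
    fixed′ i i<κ = fixed i (s≤s i<κ)
    lookup-fixed : ∀ i → toℕ i < suc t → lookup b i ≡ lookup a i
    lookup-fixed i i<κ = trans (lookup-b i) (cong (lookup a) (fixed′ i i<κ))
    b₀≡x : lookup b zero ≡ x
    b₀≡x = lookup-fixed zero z<s
    b-desc : Descending (drop (suc t) b)
    b-desc = Descending-drop (suc t) b λ i j κ≤i eq → subst id (sym (cong₂ _≤_ (lookup-b j) (lookup-b i))) (desc i j (s≤s κ≤i) eq)
    base : centreSize (drop (suc t) b) ≡ runLength n (drop t v)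
    base = IsRun-unique
      (λ q → trans (sym (countFrom-drop (suc t) b q)) (trans (sym (countFrom-permute (suc t) a π fixed′ q)) (countFrom-drop (suc t) a q)))
      (centreSize-isRun (drop (suc t) b) b-desc) (run-drop t N a pos)
    size : centreSize w ≡ burn t (runLength n (drop t v)) v
    size = trans (centreSize-burn t w) (trans (cong (λ r → burn t r w) base)
      (burn-cong t _ w v λ i i<t → lookup-fixed (suc i) (s≤s i<t)))

  partial⇔burns : ∀ (a : Vec ℕ n) → (InRange a × IsPartialPF (2 + t) a) ⇔ Burns t a
  partial⇔burns a@(_ ∷ _) = mk⇔ to from
    where
    to : InRange a × IsPartialPF (2 + t) a → Burns t a
    to (range , parks , π , sorting , Z , (cand , _) , i , i≡0 , i∈Z) with refl ← toℕ-injective {i = i} {j = zero} i≡0 =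
      range ,
      last⇒allParked n (suc t) a (λ i κ≤i → ≤-trans (≤-reflexive (sym (parkingPos-parkedAt a i))) (parks i (s≤s κ≤i))) ,
      Equivalence.to (centre-first a (proj₁ ∘ range) π sorting)
        (centre-largest (compose a π) Z (λ s s∈ → cand s (lookup⇒[]= s Z s∈)) zero ([]=⇒lookup i∈Z))
    from : Burns t a → InRange a × IsPartialPF (2 + t) a
    from (range , parked , first) with π , sorting ← sortingPerm (suc t) a =
      range ,
      (λ i k≤i → ≤-trans (≤-reflexive (parkingPos-parkedAt a i)) (allParked⇒last n (suc t) a parked i (≤-pred k≤i))) ,
      π , sorting , centre b , centre-isCentre b , zero , refl ,
      lookup⇒[]= zero (centre b) (Equivalence.from (centre-first a (proj₁ ∘ range) π sorting) first)
      where b = compose a π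

lookup-ext : {A : Set} {n : ℕ} {xs ys : Vec A n} → (∀ i → lookup xs i ≡ lookup ys i) → xs ≡ ys
lookup-ext {xs = xs} {ys} eq = trans (sym (tabulate∘lookup xs)) (trans (tabulate-cong eq) (tabulate∘lookup ys))

sumTo : ℕ → (ℕ → ℕ) → ℕ
sumTo zero    f = 0
sumTo (suc u) f = f u + sumTo u f

sumTo-cong : ∀ u {f g : ℕ → ℕ} → (∀ j → j < u → f j ≡ g j) → sumTo u f ≡ sumTo u g
sumTo-cong zero    eq = refl
sumTo-cong (suc u) eq = cong₂ _+_ (eq u ≤-refl) (sumTo-cong u λ j j<u → eq j (m≤n⇒m≤1+n j<u))

#-insert : ∀ {n} (S : Vec Bool n) i → # (lookup (S [ i ]≔ true)) ≤ suc (# (lookup S))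
#-insert (s ∷ S) zero = begin
  # (lookup (true ∷ S))     ≡⟨ #-suc _ ⟩
  suc (# (lookup S))        ≤⟨ s≤s (m≤n+m _ (𝟙 s)) ⟩
  suc (𝟙 s + # (lookup S))  ≡⟨ cong suc (#-suc _) ⟨
  suc (# (lookup (s ∷ S)))  ∎
  where open ≤-Reasoning
#-insert (s ∷ S) (suc i) = begin
  # (lookup (s ∷ (S [ i ]≔ true)))       ≡⟨ #-suc _ ⟩
  𝟙 s + # (lookup (S [ i ]≔ true))       ≤⟨ +-monoʳ-≤ (𝟙 s) (#-insert S i) ⟩
  𝟙 s + suc (# (lookup S))               ≡⟨ +-suc (𝟙 s) _ ⟩
  suc (𝟙 s + # (lookup S))               ≡⟨ cong suc (#-suc _) ⟨
  suc (# (lookup (s ∷ S)))               ∎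
  where open ≤-Reasoning

-- Parking on a circle

module Circle (n : ℕ) where

  Position State : Set
  Position = Fin (suc n)
  State    = Vec Bool (suc n)

  next prev : Position → Position
  next q with toℕ q <? n
  ... | yes q<n = suc (fromℕ< q<n)
  ... | no  _   = zero
  prev zero    = fromℕ n
  prev (suc q) = inject₁ q

  toℕ-next : ∀ q → toℕ q < n → toℕ (next q) ≡ suc (toℕ q)
  toℕ-next q q<n with toℕ q <? n
  ... | yes q<n′ = cong suc (toℕ-fromℕ< q<n′)
  ... | no  q≮n  = ⊥-elim (q≮n q<n)

  next-last : ∀ q → n ≤ toℕ q → next q ≡ zero
  next-last q n≤q with toℕ q <? n
  ... | yes q<n = ⊥-elim (<⇒≱ q<n n≤q)
  ... | no  _   = refl

  next-prev : ∀ q → next (prev q) ≡ q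
  next-prev zero    = next-last (fromℕ n) (≤-reflexive (sym (toℕ-fromℕ n)))
  next-prev (suc q) = toℕ-injective (trans
    (toℕ-next (inject₁ q) (≤-trans (≤-reflexive (cong suc (toℕ-inject₁ q))) (toℕ<n q)))
    (cong suc (toℕ-inject₁ q)))

  prev-next : ∀ q → prev (next q) ≡ q
  prev-next q with toℕ q <? n
  ... | yes q<n = toℕ-injective (trans (toℕ-inject₁ _) (toℕ-fromℕ< q<n))
  ... | no  q≮n = toℕ-injective (trans (toℕ-fromℕ n) (≤-antisym (≮⇒≥ q≮n) (≤-pred (toℕ<n q))))

  shift : Permutation′ (suc n)
  shift = Perm.permutation next prev next-prev prev-next

  circularSpot : ℕ → State → Position → Position
  circularSpot zero    S p = p
  circularSpot (suc f) S p = if lookup S p then circularSpot f S (next p) else p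

  -- With fuel `n` the search tests n of the n + 1 positions and otherwise returns the one that
  -- remains.
  place : Position → State → State
  place p S = S [ circularSpot n S p ]≔ true

  rotate : State → State
  rotate S = tabulate (lookup S ∘ prev)

  lookup-rotate : ∀ S q → lookup (rotate S) (next q) ≡ lookup S q
  lookup-rotate S q = trans (lookup∘tabulate (lookup S ∘ prev) (next q)) (cong (lookup S) (prev-next q))

  circularSpot-rotate : ∀ f S p → circularSpot f (rotate S) (next p) ≡ next (circularSpot f S p)
  circularSpot-rotate zero    S p = refl
  circularSpot-rotate (suc f) S p rewrite lookup-rotate S p with lookup S p
  ... | true  = circularSpot-rotate f S (next p)
  ... | false = refl

  place-rotate : ∀ p S → rotate (place p S) ≡ place (next p) (rotate S)
  place-rotate p S rewrite circularSpot-rotate n S p = lookup-ext λ q →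
    trans (lookup∘tabulate (lookup (place p S) ∘ prev) q) (at q)
    where
    s = circularSpot n S p
    at : ∀ q → lookup (S [ s ]≔ true) (prev q) ≡ lookup (rotate S [ next s ]≔ true) q
    at q with q Fin.≟ next s
    ... | yes refl = trans (cong (lookup (S [ s ]≔ true)) (prev-next s))
                       (trans (lookup∘update s S true) (sym (lookup∘update (next s) (rotate S) true)))
    ... | no q≢ = trans (lookup∘update′ (λ eq → q≢ (trans (sym (next-prev q)) (cong next eq))) S true)
                    (sym (trans (lookup∘update′ q≢ (rotate S) true) (lookup∘tabulate (lookup S ∘ prev) q)))

  place-grows : ∀ p S q → lookup S q ≡ true → lookup (place p S) q ≡ true
  place-grows p S q q∈S with q Fin.≟ circularSpot n S p
  ... | yes refl = lookup∘update q S true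
  ... | no  q≢   = trans (lookup∘update′ q≢ S true) q∈S

  -- Sum of F over the final states of all (n + 1) ^ m preference sequences.
  total : ℕ → (State → ℕ) → ℕ
  total zero    F = F (replicate (suc n) false)
  total (suc m) F = total m (λ S → sum (λ p → F (place p S)))

  -- After m cars at most m positions are occupied. Carrying this bound along later guarantees an
  -- empty position.
  total-cong : ∀ m {F G : State → ℕ} → (∀ S → # (lookup S) ≤ m → F S ≡ G S) → total m F ≡ total m G
  total-cong zero    eq = eq _ (≤-reflexive (trans (#-sum _) (sum-zero λ i → cong 𝟙 (lookup-replicate {n = suc n} i false))))
  total-cong (suc m) eq = total-cong m λ S S≤m → sum-cong-≗ λ p →
    eq (place p S) (≤-trans (#-insert S (circularSpot n S p)) (s≤s S≤m))

  -- Placing commutes with rotating when the preference is rotated too, and the preferences run over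
  -- the whole circle, so the rotation is absorbed by reindexing them.
  total-rotate : ∀ m (F : State → ℕ) → total m (F ∘ rotate) ≡ total m F
  total-rotate zero    F = cong F (lookup-ext {xs = rotate (replicate (suc n) false)} λ i →
    trans (lookup∘tabulate (lookup (replicate (suc n) false) ∘ prev) i)
    (trans (lookup-replicate {n = suc n} (prev i) false) (sym (lookup-replicate {n = suc n} i false))))
  total-rotate (suc m) F = trans
    (total-cong m λ S _ → trans (sum-cong-≗ λ p → cong F (place-rotate p S))
                                (sym (sum-permute (λ p → F (place p (rotate S))) shift)))
    (total-rotate m (λ S → sum (λ p → F (place p S))))

  total-+ : ∀ m (F G : State → ℕ) → total m (λ S → F S + G S) ≡ total m F + total m G
  total-+ zero    F G = refl
  total-+ (suc m) F G = trans (total-cong m λ S _ → ∑-distrib-+ (λ p → F (place p S)) (λ p → G (place p S)))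
                              (total-+ m _ _)

  total-const : ∀ m c → total m (λ _ → c) ≡ suc n ^ m * c
  total-const zero    c = sym (+-identityʳ c)
  total-const (suc m) c = trans (total-cong m λ _ _ → sum-const (suc n) c)
    (trans (total-const m (suc n * c)) (rearrange (suc n) (suc n ^ m) c))
    where
    rearrange : ∀ x y z → y * (x * z) ≡ x * y * z
    rearrange = solve-∀

  total-sumTo : ∀ m u (F : ℕ → State → ℕ) → total m (λ S → sumTo u (λ j → F j S)) ≡ sumTo u (λ j → total m (F j))
  total-sumTo m zero    F = trans (total-const m 0) (*-zeroʳ (suc n ^ m))
  total-sumTo m (suc u) F = trans (total-+ m (F u) _) (cong (total m (F u) +_) (total-sumTo m u F))

  runAfter : ℕ → Position → State → Bool
  runAfter zero    q S = true
  runAfter (suc j) q S = lookup S (next q) ∧ runAfter j (next q) S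

  gapThenRun : ℕ → Position → State → ℕ
  gapThenRun j q S = 𝟙 (not (lookup S q) ∧ runAfter j q S)

  runAfter-rotate : ∀ j q S → runAfter j (next q) (rotate S) ≡ runAfter j q S
  runAfter-rotate zero    q S = refl
  runAfter-rotate (suc j) q S = cong₂ _∧_ (lookup-rotate S (next q)) (runAfter-rotate j (next q) S)

  total-gapThenRun-next : ∀ m j q → total m (gapThenRun j (next q)) ≡ total m (gapThenRun j q)
  total-gapThenRun-next m j q = trans (sym (total-rotate m (gapThenRun j (next q))))
    (total-cong m λ S _ → cong 𝟙 (cong₂ (λ b c → not b ∧ c) (lookup-rotate S q) (runAfter-rotate j q S)))

  back : ℕ → Position
  back zero    = zero
  back (suc i) = prev (back i)

  total-gapThenRun-back : ∀ m j i → total m (gapThenRun j (back i)) ≡ total m (gapThenRun j zero)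
  total-gapThenRun-back m j zero    = refl
  total-gapThenRun-back m j (suc i) = trans (sym (total-gapThenRun-next m j (back (suc i))))
    (trans (cong (λ q → total m (gapThenRun j q)) (next-prev (back i))) (total-gapThenRun-back m j i))

  runBefore : ℕ → State → Bool
  runBefore zero    S = true
  runBefore (suc j) S = lookup S (back j) ∧ runBefore j S

  runAfter-back : ∀ j S → runAfter j (back j) S ≡ runBefore j S
  runAfter-back zero    S = refl
  runAfter-back (suc j) S rewrite next-prev (back j) = cong (lookup S (back j) ∧_) (runAfter-back j S)

  -- The term for j says that position -j is empty and 0, -1, ..., -(j - 1) are occupied. These
  -- events exclude one another, and none of them occurs for j < u exactly when the u positions
  -- going back from 0 are all occupied.
  gaps-telescope : ∀ S u → sumTo u (λ j → gapThenRun j (back j) S) + 𝟙 (runBefore u S) ≡ 1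
  gaps-telescope S zero    = refl
  gaps-telescope S (suc u) rewrite runAfter-back u S = trans
    (split (lookup S (back u)) (runBefore u S) (sumTo u (λ j → gapThenRun j (back j) S)))
    (gaps-telescope S u)
    where
    split : ∀ s b x → 𝟙 (not s ∧ b) + x + 𝟙 (s ∧ b) ≡ x + 𝟙 b
    split true  b x = refl
    split false b x = trans (+-identityʳ _) (+-comm (𝟙 b) x)

  toℕ-back : ∀ i → i ≤ n → toℕ (back (suc i)) + i ≡ n
  toℕ-back zero    _   = trans (+-identityʳ _) (toℕ-fromℕ n)
  toℕ-back (suc i) i<n with back (suc i) | toℕ-back i (<⇒≤ i<n)
  ... | zero  | i≡n = ⊥-elim (<⇒≢ i<n i≡n)
  ... | suc q | eq  = trans (cong (_+ suc i) (toℕ-inject₁ q)) (trans (+-suc (toℕ q) i) eq)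

  back-surjective : ∀ q → ∃ λ j → j ≤ n × back j ≡ q
  back-surjective zero    = 0 , z≤n , refl
  back-surjective (suc q) with i , eq ← m≤n⇒∃[o]m+o≡n (toℕ<n q) =
    suc i , ≤-trans (s≤s (m≤n+m i (toℕ q))) (≤-reflexive eq) ,
    toℕ-injective (+-cancelʳ-≡ i _ _ (trans (toℕ-back i (≤-trans (m≤n+m i (suc (toℕ q))) (≤-reflexive eq))) (sym eq)))

  runBefore⇒ : ∀ u S → runBefore u S ≡ true → ∀ j → j < u → lookup S (back j) ≡ true
  runBefore⇒ (suc u) S full j (s≤s j≤u) with su , full′ ← ∧-true {lookup S (back u)} full with m≤n⇒m<n∨m≡n j≤u
  ... | inj₁ j<u  = runBefore⇒ u S full′ j j<u
  ... | inj₂ refl = su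

  not-full : ∀ S → # (lookup S) ≤ n → runBefore (suc n) S ≡ false
  not-full S S≤n with runBefore (suc n) S in eq
  ... | false = refl
  ... | true  = ⊥-elim (<⇒≱ ≤-refl (begin
    suc n                            ≡⟨ #-≥ {suc n} 0 z≤n ⟨
    # {suc n} (λ _ → true) + 0       ≡⟨ +-identityʳ _ ⟩
    # {suc n} (λ _ → true)           ≤⟨ #-mono (λ q _ → all q) ⟩
    # (lookup S)                     ≤⟨ S≤n ⟩
    n                                ∎))
    where
    open ≤-Reasoning
    all : ∀ q → lookup S q ≡ true
    all q with j , j≤n , refl ← back-surjective q = runBefore⇒ (suc n) S eq j (s≤s j≤n)

  -- If 0 is empty, the terms for j = 0, ..., r are 1, where r is the length of the run after 0, so
  -- the value is the first empty spot r + 1 (n + 1 standing for 0 itself). As a sum over j it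
  -- allows a different rotation for each term.
  firstGap : State → ℕ
  firstGap S = sumTo (suc n) (λ j → gapThenRun j zero S)

  -- Rotating by j turns "0 is empty and 1, …, j are occupied" into "-j is the
  -- first empty position met going back from 0", true of exactly one j.
  total-firstGap : ∀ m → m ≤ n → total m firstGap ≡ suc n ^ m
  total-firstGap m m≤n = begin
    total m firstGap                                                ≡⟨ total-sumTo m (suc n) (λ j → gapThenRun j zero) ⟩
    sumTo (suc n) (λ j → total m (gapThenRun j zero))
      ≡⟨ sumTo-cong (suc n) (λ j _ → total-gapThenRun-back m j j) ⟨
    sumTo (suc n) (λ j → total m (gapThenRun j (back j)))           ≡⟨ total-sumTo m (suc n) (λ j → gapThenRun j (back j)) ⟨
    total m (λ S → sumTo (suc n) (λ j → gapThenRun j (back j) S))   ≡⟨ total-cong m (λ S S≤m → exactlyOne S (≤-trans S≤m m≤n)) ⟩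
    total m (λ _ → 1)                                               ≡⟨ total-const m 1 ⟩
    suc n ^ m * 1                                                   ≡⟨ *-identityʳ _ ⟩
    suc n ^ m                                                       ∎
    where
    open ≡-Reasoning
    exactlyOne : ∀ S → # (lookup S) ≤ n → sumTo (suc n) (λ j → gapThenRun j (back j) S) ≡ 1
    exactlyOne S S≤n = trans (sym (+-identityʳ _)) (trans
      (cong (λ b → sumTo (suc n) (λ j → gapThenRun j (back j) S) + 𝟙 b) (sym (not-full S S≤n)))
      (gaps-telescope S (suc n)))

  firstGap-occupied : ∀ S → lookup S zero ≡ true → firstGap S ≡ 0
  firstGap-occupied S 0∈S rewrite 0∈S = zeros (suc n)
    where
    zeros : ∀ u → sumTo u (λ _ → 0) ≡ 0
    zeros zero    = refl
    zeros (suc u) = zeros u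

  next^ : ℕ → Position → Position
  next^ zero    q = q
  next^ (suc j) q = next^ j (next q)

  toℕ-next^ : ∀ j q → toℕ q + j ≤ n → toℕ (next^ j q) ≡ toℕ q + j
  toℕ-next^ zero    q _ = sym (+-identityʳ _)
  toℕ-next^ (suc j) q le rewrite +-suc (toℕ q) j = trans
    (toℕ-next^ j (next q) (≤-trans (≤-reflexive (cong (_+ j) step)) le)) (cong (_+ j) step)
    where
    step : toℕ (next q) ≡ suc (toℕ q)
    step = toℕ-next q (≤-trans (s≤s (m≤m+n _ j)) le)

  -- On the circle a run is peeled off at its near end, which suits rotation; `run` on the line
  -- peels it off at its far end. This passes from one to the other.
  runAfter-snoc : ∀ j q S → runAfter (suc j) q S ≡ lookup S (next^ (suc j) q) ∧ runAfter j q S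
  runAfter-snoc zero    q S = refl
  runAfter-snoc (suc j) q S = trans (cong (lookup S (next q) ∧_) (runAfter-snoc j (next q) S))
    (∧-swap (lookup S (next q)) (lookup S (next^ (suc j) (next q))) (runAfter j (next q) S))
    where
    ∧-swap : ∀ a b c → a ∧ (b ∧ c) ≡ b ∧ (a ∧ c)
    ∧-swap true  b c = refl
    ∧-swap false b c = sym (∧-zeroʳ b)

  wrap : (ℕ → Bool) → State
  wrap o = tabulate (o ∘ toℕ)

  lookup-wrap : ∀ o q → lookup (wrap o) q ≡ o (toℕ q)
  lookup-wrap o = lookup∘tabulate (o ∘ toℕ)

  runAfter-wrap : ∀ o j → j ≤ n → runAfter j zero (wrap o) ≡ run o j
  runAfter-wrap o zero    _   = refl
  runAfter-wrap o (suc j) j<n = trans (runAfter-snoc j zero (wrap o)) (cong₂ _∧_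
    (trans (lookup-wrap o (next^ (suc j) zero)) (cong o (toℕ-next^ (suc j) zero j<n)))
    (runAfter-wrap o j (<⇒≤ j<n)))

  firstGap-wrap : ∀ o → o 0 ≡ false → firstGap (wrap o) ≡ suc (leadingRun o n)
  firstGap-wrap o o0 = trans (sumTo-cong (suc n) λ j j≤n → cong 𝟙 (cong₂ (λ b c → not b ∧ c)
      (trans (lookup-wrap o zero) o0) (runAfter-wrap o j (≤-pred j≤n)))) (runs n)
    where
    runs : ∀ u → sumTo (suc u) (λ j → 𝟙 (run o j)) ≡ suc (leadingRun o u)
    runs zero    = refl
    runs (suc u) = trans (cong (𝟙 (run o (suc u)) +_) (runs u)) (+-suc _ _)

  module _ (o : ℕ → Bool) (o0 : o 0 ≡ false) where

    circularSpot-zero : ∀ f → circularSpot f (wrap o) zero ≡ zero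
    circularSpot-zero zero    = refl
    circularSpot-zero (suc f) rewrite trans (lookup-wrap o zero) o0 = refl

    circularSpot-fits : ∀ f p → spot f o (toℕ p) ≤ n → toℕ (circularSpot f (wrap o) p) ≡ spot f o (toℕ p)
    circularSpot-fits zero    p _   = refl
    circularSpot-fits (suc f) p s≤n rewrite lookup-wrap o p with o (toℕ p)
    ... | false = refl
    ... | true = trans (circularSpot-fits f (next p) (subst (λ z → spot f o z ≤ n) (sym step) s≤n)) (cong (spot f o) step)
      where
      step : toℕ (next p) ≡ suc (toℕ p)
      step = toℕ-next p (≤-trans (spot-≥ f o (suc (toℕ p))) s≤n)

    -- A car that leaves the line at n comes round to position 0, which is still empty and stops it.
    circularSpot-overflow : ∀ f p → n < spot f o (toℕ p) → circularSpot f (wrap o) p ≡ zero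
    circularSpot-overflow zero    p n<p = ⊥-elim (<⇒≱ n<p (≤-pred (toℕ<n p)))
    circularSpot-overflow (suc f) p n<s rewrite lookup-wrap o p with o (toℕ p)
    ... | false = ⊥-elim (<⇒≱ n<s (≤-pred (toℕ<n p)))
    ... | true with toℕ p <? n
    ...   | yes p<n = circularSpot-overflow f (suc (fromℕ< p<n)) (subst (λ z → n < spot f o z) (cong suc (sym (toℕ-fromℕ< p<n))) n<s)
    ...   | no  _   = circularSpot-zero f

    place-wrap-zero : lookup (place zero (wrap o)) zero ≡ true
    place-wrap-zero rewrite circularSpot-zero n = refl

    place-wrap-overflow : ∀ p → n < spot n o (toℕ p) → lookup (place p (wrap o)) zero ≡ true
    place-wrap-overflow p n<s rewrite circularSpot-overflow n p n<s = refl

    place-wrap-fits : ∀ p → spot n o (toℕ p) ≤ n → place p (wrap o) ≡ wrap (occupy (spot n o (toℕ p)) o)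
    place-wrap-fits p s≤n = lookup-ext λ q → trans (at q) (sym (lookup-wrap (occupy s o) q))
      where
      s = spot n o (toℕ p)
      c = circularSpot n (wrap o) p
      c≡s : toℕ c ≡ s
      c≡s = circularSpot-fits n p s≤n
      at : ∀ q → lookup (wrap o [ c ]≔ true) q ≡ occupy s o (toℕ q)
      at q with q Fin.≟ c
      ... | yes refl = trans (lookup∘update c (wrap o) true) (sym (trans (cong (occupy s o) c≡s) (occupy-self s o)))
      ... | no  q≢c  = trans (lookup∘update′ q≢c (wrap o) true) (trans (lookup-wrap o q)
                         (sym (occupy-other o λ eq → q≢c (toℕ-injective (trans eq (sym c≡s))))))

-- Counting

lsum-cartesianProductWith : {A B C : Set} (F : C → ℕ) (f : A → B → C) (xs : List A) (ys : List B) →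
  lsum F (cartesianProductWith f xs ys) ≡ lsum (λ x → lsum (λ y → F (f x y)) ys) xs
lsum-cartesianProductWith F f []       ys = refl
lsum-cartesianProductWith F f (x ∷ xs) ys = trans (lsum-++ F (List.map (f x) ys) _)
  (cong₂ _+_ (lsum-map F (f x) ys) (lsum-cartesianProductWith F f xs ys))

lsum-allFin : ∀ {n} (F : Fin n → ℕ) → lsum F (List.allFin n) ≡ sum F
lsum-allFin {n} F = go id
  where
  go : ∀ {m} (g : Fin m → Fin n) → lsum F (List.tabulate g) ≡ sum (F ∘ g)
  go {zero}  g = refl
  go {suc m} g = cong (F (g zero) +_) (go (g ∘ suc))

Within : ∀ {m} → ℕ → Vec ℕ m → Set
Within n v = ∀ i → 1 ≤ lookup v i × lookup v i ≤ n

module _ (n : ℕ) where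

  extend : ∀ {m} → Vec ℕ m → Fin n → Vec ℕ (suc m)
  extend v i = label i ∷ v

  vectors : ∀ m → List (Vec ℕ m)
  vectors zero    = [] ∷ []
  vectors (suc m) = cartesianProductWith extend (vectors m) (List.allFin n)

  vectors-unique : ∀ m → Unique (vectors m)
  vectors-unique zero    = [] ∷ []
  vectors-unique (suc m) = Unique.cartesianProductWith⁺ extend
    (λ { eq → cong Vec.tail eq , toℕ-injective (suc-injective (cong Vec.head eq)) })
    (vectors-unique m) (Unique.allFin⁺ n)

  ∈-vectors⁺ : ∀ {m} (v : Vec ℕ m) → Within n v → v ∈ vectors m
  ∈-vectors⁺ []            _ = here refl
  ∈-vectors⁺ (zero ∷ v)  within = ⊥-elim (n≮0 (proj₁ (within zero)))
  ∈-vectors⁺ (suc x ∷ v) within = subst (λ y → suc y ∷ v ∈ vectors _) (toℕ-fromℕ< x<n)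
    (∈-cartesianProductWith⁺ extend (∈-vectors⁺ v (within ∘ suc)) (∈-allFin (fromℕ< x<n)))
    where
    x<n : x < n
    x<n = proj₂ (within zero)

  Within-extend : ∀ {m} {v : Vec ℕ m} → Within n v → ∀ i → Within n (extend v i)
  Within-extend within i zero    = s≤s z≤n , toℕ<n i
  Within-extend within i (suc j) = within j

  ∈-vectors⁻ : ∀ {m} {v : Vec ℕ m} → v ∈ vectors m → Within n v
  ∈-vectors⁻ {zero}  _  = λ ()
  ∈-vectors⁻ {suc m} v∈ with _ , i , w∈ , _ , refl ← ∈-cartesianProductWith⁻ extend (vectors m) (List.allFin n) v∈ =
    Within-extend (∈-vectors⁻ w∈) i

  vsum : ∀ m → (Vec ℕ m → ℕ) → ℕ
  vsum m F = lsum F (vectors m)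

  vsum-suc : ∀ m F → vsum (suc m) F ≡ lsum (λ v → sum (λ i → F (extend v i))) (vectors m)
  vsum-suc m F = trans (lsum-cartesianProductWith F extend (vectors m) (List.allFin n))
    (lsum-ext (vectors m))
    where
    lsum-ext : ∀ vs → lsum (λ v → lsum (λ i → F (extend v i)) (List.allFin n)) vs ≡ lsum (λ v → sum (λ i → F (extend v i))) vs
    lsum-ext []       = refl
    lsum-ext (v ∷ vs) = cong₂ _+_ (lsum-allFin (λ i → F (extend v i))) (lsum-ext vs)

  vsum-cong : ∀ m {F G : Vec ℕ m → ℕ} → (∀ v → Within n v → F v ≡ G v) → vsum m F ≡ vsum m G
  vsum-cong zero eq = cong (_+ 0) (eq [] λ ())
  vsum-cong (suc m) {F} {G} eq = trans (vsum-suc m F) (trans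
    (vsum-cong m λ v within → sum-cong-≗ λ i → eq (extend v i) (Within-extend within i))
    (sym (vsum-suc m G)))

  vsum-*ˡ : ∀ m c F → vsum m (λ v → c * F v) ≡ c * vsum m F
  vsum-*ˡ m c F = go (vectors m)
    where
    go : ∀ vs → lsum (λ v → c * F v) vs ≡ c * lsum F vs
    go []       = sym (*-zeroʳ c)
    go (v ∷ vs) = trans (cong (c * F v +_) (go vs)) (sym (*-distribˡ-+ c (F v) _))

  open Circle n

  -- The circle allows the extra preference 0 and lets cars overflow, but both occupy position 0,
  -- where `G` vanishes. In the induction `G` is replaced by its sum over one more car; this
  -- vanishes there as well, since occupied positions stay occupied.
  vsum-total : ∀ m (G : State → ℕ) → (∀ S → lookup S zero ≡ true → G S ≡ 0) →
    vsum m (λ v → 𝟙 (allParked n v) * G (wrap (occupied n v))) ≡ total m G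
  vsum-total zero G _ = trans (+-identityʳ _) (trans (+-identityʳ _) (cong G (lookup-ext {xs = wrap (λ _ → false)} λ i →
    trans (lookup-wrap (λ _ → false) i) (sym (lookup-replicate {n = suc n} i false)))))
  vsum-total (suc m) G G0 = trans (vsum-suc m _) (trans
    (vsum-cong m pointwise)
    (vsum-total m (λ S → sum (λ p → G (place p S))) λ S 0∈S → sum-zero λ p → G0 (place p S) (place-grows p S zero 0∈S)))
    where
    pointwise : ∀ v → Within n v →
      sum {n} (λ i → 𝟙 (allParked n (extend v i)) * G (wrap (occupied n (extend v i)))) ≡
      𝟙 (allParked n v) * sum (λ p → G (place p (wrap (occupied n v))))
    pointwise v within with allParked n v
    ... | false = sum-zero {n} λ i → cong (λ b → 𝟙 b * G (wrap (occupied n (extend v i))))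
                    (∧-zeroʳ (spot n (occupied n v) (label i) ≤ᵇ n))
    ... | true = sym (trans (+-identityʳ _) (cong₂ _+_
                   (G0 _ (place-wrap-zero o o0))
                   (sum-cong-≗ {n} at)))
      where
      o = occupied n v
      o0 : o 0 ≡ false
      o0 = occ-zero n v (proj₁ ∘ within)
      at : ∀ i → G (place (suc i) (wrap o)) ≡ 𝟙 ((spot n o (label i) ≤ᵇ n) ∧ true) * G (wrap (occupied n (extend v i)))
      at i with spot n o (label i) ≤? n
      ... | yes s≤n rewrite ≤ᵇ-true s≤n = trans (cong G (place-wrap-fits o o0 (suc i) s≤n)) (sym (+-identityʳ _))
      ... | no  s≰n rewrite ≤ᵇ-false (≰⇒> s≰n) = G0 _ (place-wrap-overflow o o0 (suc i) (≰⇒> s≰n))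

  vsum-runLength : ∀ N → N ≤ n → vsum N (λ v → 𝟙 (allParked n v) * suc (runLength n v)) ≡ suc n ^ N
  vsum-runLength N N≤n = trans
    (vsum-cong N λ v within → cong (𝟙 (allParked n v) *_) (sym (firstGap-wrap (occupied n v) (occ-zero n v (proj₁ ∘ within)))))
    (trans (vsum-total N firstGap firstGap-occupied) (total-firstGap N N≤n))

  sum-label≤ : ∀ {m} c → c ≤ m → sum {m} (λ i → 𝟙 (label i ≤ᵇ c)) ≡ c
  sum-label≤ {m}     zero    _         = sum-zero {m} λ _ → refl
  sum-label≤ {suc m} (suc c) (s≤s c≤m) = cong suc (sum-label≤ {m} c c≤m)

  burn-upper : ∀ t {N} r (v : Vec ℕ (t + N)) → r ≤ N → burn t r v ≤ t + N
  burn-upper zero    r v       r≤N = r≤N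
  burn-upper (suc t) r (x ∷ v) r≤N = +-mono-≤ (𝟙≤1 (x ≤ᵇ suc (burn t r v))) (burn-upper t r v r≤N)

  burnCount : ∀ t {N} → Vec ℕ (t + N) → ℕ
  burnCount t v = burn t (runLength n (drop t v)) v

  burnCount-upper : ∀ t {N} (v : Vec ℕ (t + N)) → t + N < n → Within n v → burnCount t v ≤ t + N
  burnCount-upper t {N} v t+N<n within = burn-upper t _ v (≤-trans (proj₁ isRun _ ≤-refl) (count≤-upper (drop t v) _))
    where
    isRun = leadingRun-isRun n (drop t v) (≤-trans (s≤s (m≤n+m N t)) t+N<n) (Positive-drop t v (proj₁ ∘ within))

  -- Let b vertices be burnt when a middle entry is added. Of its n values exactly b + 1 raise b by
  -- one, so the sum of the new (burnt + 1) is n (b + 1) + (b + 1) = (n + 1) (b + 1).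
  vsum-burnCount : ∀ t N → t + N < n → vsum (t + N) (λ v → 𝟙 (allParked n (drop t v)) * suc (burnCount t v)) ≡ suc n ^ (t + N)
  vsum-burnCount zero    N N<n = vsum-runLength N (<⇒≤ N<n)
  vsum-burnCount (suc t) N lt = trans (vsum-suc (t + N) _) (trans
    (vsum-cong (t + N) pointwise) (trans (vsum-*ˡ (t + N) (suc n) _) (cong (suc n *_) (vsum-burnCount t N (<⇒≤ lt)))))
    where
    rearrange : ∀ p n b → b * p + n * (b * p) ≡ (1 + n) * (p * b)
    rearrange = solve-∀
    pointwise : ∀ v → Within n v →
      sum {n} (λ i → 𝟙 (allParked n (drop t v)) * suc (burnStep (label i) (burnCount t v))) ≡
      suc n * (𝟙 (allParked n (drop t v)) * suc (burnCount t v))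
    pointwise v within = begin
      sum {n} (λ i → p * suc (𝟙 (label i ≤ᵇ suc b) + b))
        ≡⟨ sum-cong-≗ {n} (λ i → expand p (𝟙 (label i ≤ᵇ suc b)) b) ⟩
      sum {n} (λ i → 𝟙 (label i ≤ᵇ suc b) * p + suc b * p)
        ≡⟨ ∑-distrib-+ {n} (λ i → 𝟙 (label i ≤ᵇ suc b) * p) (λ _ → suc b * p) ⟩
      sum {n} (λ i → 𝟙 (label i ≤ᵇ suc b) * p) + sum {n} (λ _ → suc b * p)
        ≡⟨ cong₂ _+_ (sum-*ʳ {n} (λ i → 𝟙 (label i ≤ᵇ suc b)) p) (sum-const n (suc b * p)) ⟩
      sum {n} (λ i → 𝟙 (label i ≤ᵇ suc b)) * p + n * (suc b * p)
        ≡⟨ cong (λ z → z * p + n * (suc b * p)) (sum-label≤ {n} (suc b) b<n) ⟩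
      suc b * p + n * (suc b * p)                                    ≡⟨ rearrange p n (suc b) ⟩
      suc n * (p * suc b)                                            ∎
      where
      open ≡-Reasoning
      b = burnCount t v
      p = 𝟙 (allParked n (drop t v))
      b<n : b < n
      b<n = ≤-trans (s≤s (burnCount-upper t v (<⇒≤ lt) within)) (<⇒≤ lt)
      expand : ∀ p s b → p * (1 + (s + b)) ≡ s * p + (1 + b) * p
      expand = solve-∀

-- The list of solutions and its length

module _ (t N : ℕ) where

  private
    n : ℕ
    n = suc (t + N)

  burnsᵇ : Vec ℕ n → Bool
  burnsᵇ (x ∷ v) = allParked n (drop t v) ∧ (x ≤ᵇ suc (burnCount n t v))

  burners : List (Vec ℕ n)
  burners = filterᵇ burnsᵇ (vectors n n)

  burners-unique : Unique burners
  burners-unique = Unique.filter⁺ (T? ∘ burnsᵇ) (vectors-unique n n)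

  ∈-burners : ∀ a → (a ∈ burners) ⇔ Burns t a
  ∈-burners a@(x ∷ v) = mk⇔ to from
    where
    to : a ∈ burners → Burns t a
    to a∈ with a∈vs , burns ← ∈-filter⁻ (T? ∘ burnsᵇ) {xs = vectors n n} a∈
      with parked , first ← ∧-true {allParked n (drop t v)} (Equivalence.to T-≡ burns) =
      ∈-vectors⁻ n a∈vs , parked , true-≤ᵇ first
    from : Burns t a → a ∈ burners
    from (range , parked , first) = ∈-filter⁺ (T? ∘ burnsᵇ) (∈-vectors⁺ n a range)
      (Equivalence.from T-≡ (∧-intro parked (≤ᵇ-true first)))

  -- If the last cars park and b vertices burn before vertex 0, exactly the values 1, ..., b + 1 are
  -- possible for the entry of vertex 0. This is where the weight `suc (burnCount n t v)` comes
  -- from.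
  length-burners : length burners ≡ suc n ^ (t + N)
  length-burners = begin
    length burners                        ≡⟨ length-filterᵇ burnsᵇ (vectors n n) ⟩
    vsum n n (𝟙 ∘ burnsᵇ)                 ≡⟨ vsum-suc n (t + N) (𝟙 ∘ burnsᵇ) ⟩
    vsum n (t + N) (λ v → sum {n} (λ i → 𝟙 (allParked n (drop t v) ∧ (label i ≤ᵇ suc (burnCount n t v)))))
                                          ≡⟨ vsum-cong n (t + N) pointwise ⟩
    vsum n (t + N) (λ v → 𝟙 (allParked n (drop t v)) * suc (burnCount n t v))
                                          ≡⟨ vsum-burnCount n t N ≤-refl ⟩
    suc n ^ (t + N)                       ∎
    where
    open ≡-Reasoning
    pointwise : ∀ v → Within n v →
      sum {n} (λ i → 𝟙 (allParked n (drop t v) ∧ (label i ≤ᵇ suc (burnCount n t v)))) ≡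
      𝟙 (allParked n (drop t v)) * suc (burnCount n t v)
    pointwise v within with allParked n (drop t v)
    ... | false = sum-zero {n} λ _ → refl
    ... | true  = trans (sum-label≤ n {n} (suc (burnCount n t v)) (s≤s (burnCount-upper n t v ≤-refl within)))
                    (sym (+-identityʳ _))

theorem5p1 : ∀ (n k : ℕ) → 3 ≤ n → 2 ≤ k → k ≤ n →
    (∀ (a : Vec ℕ n) → IsGParking (graphG n k) a ⇔ (InRange a × IsPartialPF k a))
    × (∃ λ (L : List (Vec ℕ n)) → Unique L
    × (∀ (a : Vec ℕ n) → (a ∈ L) ⇔ IsGParking (graphG n k) a)
    × (length L ≡ suc n ^ (n ∸ 1)))
theorem5p1 n (suc (suc t)) _ (s≤s (s≤s z≤n)) k≤n with d , k+d≡n ← m≤n⇒∃[o]m+o≡n k≤n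
  -- With k = t + 2 and n = k + d, the number of last vertices is n - κ = d + 1, which is positive.
  with refl ← trans (cong suc (+-suc t d)) k+d≡n =
  (λ a → ⇔-sym (partial⇔burns t (suc d) a) ⇔-∘ gparking⇔burns t (suc d) z<s a) ,
  burners t (suc d) , burners-unique t (suc d) ,
  (λ a → ⇔-sym (gparking⇔burns t (suc d) z<s a) ⇔-∘ ∈-burners t (suc d) a) ,
  length-burners t (suc d)
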